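{- As $n \to \infty$, \[ f(n,5,5) \le n^{1/3}\, 2^{O\left(\sqrt{\log n}\,\log\log n\right)}. \]
   Context: For positive integers $p,q$ with $1 \le q \le \binom{p}{2}$, a $(p,q)$-coloring of the complete graph $K_n$ is an edge-coloring of $K_n$ in which every copy of $K_p$ (every set of $p$ vertices) spans edges of at least $q$ distinct colors. $f(n,p,q)$ denotes the minimum number of colors in a $(p,q)$-coloring of $K_n$. -}

module Defs where

open import Data.Nat using (ℕ; _*_; _<_; _≥_; _≤_)
open import Data.Nat.Properties using (_<?_)
open import Data.Nat.Logarithm using (⌈log₂_⌉)
open import Data.Fin using (Fin)
import Data.Fin.Properties as FinP
open import Data.List using (List; []; _∷_; length; filter; upTo; allFin; concatMap; deduplicate)
open import Data.Product using (Σ; _×_; _,_; proj₁)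
open import Function.Definitions using (Injective)
open import Relation.Binary.PropositionalEquality using (_≡_)
open import Relation.Nullary using (yes; no)

-- An edge-colouring of K_n with k colours: a symmetric function on ordered pairs
-- of vertices (values on the diagonal are irrelevant).
Colouring : ℕ → ℕ → Set
Colouring n k = Σ (Fin n → Fin n → Fin k) λ c → ∀ x y → c x y ≡ c y x

edgeColours : ∀ {n k p} → (Fin n → Fin n → Fin k) → (Fin p → Fin n) → List (Fin k)
edgeColours {p = p} c v =
  concatMap (λ i → concatMap (λ j → pick i j) (allFin p)) (allFin p)
  where
  pick : Fin p → Fin p → List _
  pick i j with i FinP.<? j
  ... | yes _ = c (v i) (v j) ∷ []
  ... | no _  = []

numColours : ∀ {n k p} → (Fin n → Fin n → Fin k) → (Fin p → Fin n) → ℕ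
numColours c v = length (deduplicate FinP._≟_ (edgeColours c v))

IsPQColouring : ∀ {n k} → ℕ → ℕ → Colouring n k → Set
IsPQColouring {n} p q (c , _) =
  (v : Fin p → Fin n) → Injective _≡_ _≡_ v → numColours c v ≥ q

fAtMost : ℕ → ℕ → ℕ → ℕ → Set
fAtMost n p q m = Σ ℕ λ k → k ≤ m × Σ (Colouring n k) (IsPQColouring p q)

⌈√_⌉ : ℕ → ℕ
⌈√ m ⌉ = length (filter (λ s → s * s <? m) (upTo m))

{-# OPTIONS --safe #-}
module Submission where

-- An edge receives a pair of colours.
--
-- The first takes 2^O(√log n) values: write vertices as √log n blocks of √log n bits and record the
-- first bit where the ends differ, both blocks containing that bit, and for every position the sign
-- of the comparison of the two blocks there. The first bit where not all of a set S agree splits S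
-- into A and B such that no edge between A and B has a colour occurring inside A or inside B, and if
-- some colour occurs both inside A and inside B then at least three colours occur between A and B.
-- By induction five vertices with at most four colours form one of three configurations: a vertex
-- joined in one colour to a monochromatic C₄, a caterpillar (a to bcde, b to cde and c to de, each in
-- one colour), or a monochromatic K₂₃ whose larger side contains a star in one colour.
--
-- For the second, place the vertices in F_p³ with p about n^(1/3). For a shift w ∈ F_p² use the
-- colour β = x₁ + y₁ + ⟨x , y⟩ + ⟨w , x + y⟩, where ⟨x , y⟩ = x₂ y₂ + m x₃ y₃ and -m is not a square.
-- Then x and y are conjugate with respect to a quadric, so the neighbours of x in one colour lie
-- in a plane. If xy is good, i.e. its polar line misses the quadric, this plane avoids x; comparing
-- such planes excludes the three configurations. A pair of points is good for about half of the
-- shifts along an axis, hence O(log n) shifts suffice to make every pair good for one of them.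
--
-- A prime p in a suitable range exists because the least common multiple of 1, …, N is at least about
-- 2^(N/2) whereas, if all primes up to N are at most m, it is at most N^m.

open import Defs
open import Data.Nat as ℕ using (ℕ; zero; suc; z≤n; s≤s; NonZero)
import Data.Nat.Properties as ℕP
import Data.Nat.Divisibility as ℕD
open import Data.Nat.Combinatorics using (_C_; nC1≡n; nCk+nC[k+1]≡[n+1]C[k+1])
open import Data.Nat.Coprimality using (prime⇒coprime; coprime-Bézout)
open import Data.Nat.GCD using (module Bézout)
open import Data.Nat.Induction using (<-rec)
open import Data.Nat.ListAction using (sum)
open import Data.Nat.Logarithm
open import Data.Nat.Primality
  using (Prime; composite; prime?; euclidsLemma; prime⇒nonZero; prime⇒nonTrivial)
open import Data.Nat.Primality.Factorisation using (factorise; PrimeFactorisation)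
import Data.Nat.Tactic.RingSolver as ℕ-Ring
open import Data.Integer as ℤ using (ℤ)
import Data.Integer.Properties as ℤP
import Data.Integer.Tactic.RingSolver as ℤ-Ring
open import Data.Fin using
  (Fin; zero; suc; toℕ; fromℕ<; inject≤; combine; remQuot; quotient; remainder; finToFun; funToFin)
open import Data.Fin.Patterns using (0F; 1F; 2F; 3F; 4F; 5F; 6F; 7F; 8F; 9F)
import Data.Fin.Properties as FinP
import Data.Vec.Functional as Vector
open import Data.List using
  (List; []; _∷_; _++_; length; filter; map; upTo; allFin; tabulate; cartesianProduct)
open import Data.List.Properties using (length-++; length-map; length-filter; length-tabulate; length-upTo)
open import Data.List.Membership.Propositional using (_∈_; find; lose)
open import Data.List.Membership.Propositional.Properties
open import Data.List.Relation.Unary.All as All using ([]; _∷_)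
open import Data.List.Relation.Unary.All.Properties using (¬All⇒Any¬)
open import Data.List.Relation.Unary.AllPairs using ([]; _∷_)
open import Data.List.Relation.Unary.Any as Any using (here; there)
open import Data.List.Relation.Unary.Unique.Propositional using (Unique)
open import Data.List.Relation.Unary.Unique.Propositional.Properties
  using (++⁺; allFin⁺; filter⁺; tabulate⁺; upTo⁺)
open import Data.Product using (Σ; ∃; ∃₂; _×_; _,_; proj₁; proj₂)
open import Data.Sum as Sum using (_⊎_; inj₁; inj₂)
open import Data.Empty using (⊥; ⊥-elim)
open import Function using (_∘_)
open import Relation.Binary.Definitions using (DecidableEquality; tri<; tri≈; tri>)
open import Relation.Binary.PropositionalEquality
open import Relation.Nullary using (¬_; Dec; yes; no; contradiction; ¬?)
open import Relation.Nullary.Decidable using (_×-dec_; decidable-stable)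
open import Relation.Unary using (Decidable)

-- Primes in an interval, by bounding common multiples of 1, ..., N from both sides.

module PrimeGap where

  open import Data.Nat
  open import Data.Nat.Properties
  open ℕ-Ring using (solve-∀)
  open import Data.Nat.Divisibility hiding (quotient)

  absorption : ∀ n k → suc n * (n C k) ≡ suc k * (suc n C suc k)
  absorption n zero = begin
    suc n * (n C 0)        ≡⟨ *-identityʳ (suc n) ⟩
    suc n                  ≡⟨ nC1≡n (suc n) ⟨
    suc n C 1              ≡⟨ *-identityˡ _ ⟨
    1 * (suc n C 1)        ∎
    where open ≡-Reasoning
  absorption zero (suc k) = sym (*-zeroʳ (2 + k))
  absorption (suc n) (suc k) = begin
    suc N * (N C K)                                    ≡⟨ cong (λ c → N C K + N * c) (nCk+nC[k+1]≡[n+1]C[k+1] n k) ⟨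
    N C K + N * (n C k + n C K)                        ≡⟨ cong (N C K +_) (*-distribˡ-+ N (n C k) (n C K)) ⟩
    N C K + (N * (n C k) + N * (n C K))                ≡⟨ cong₂ (λ u v → N C K + (u + v)) (absorption n k) (absorption n K) ⟩
    N C K + (K * (N C K) + suc K * (N C suc K))        ≡⟨ +-assoc (N C K) _ _ ⟨
    suc K * (N C K) + suc K * (N C suc K)              ≡⟨ *-distribˡ-+ (suc K) (N C K) (N C suc K) ⟨
    suc K * (N C K + N C suc K)                        ≡⟨ cong (suc K *_) (nCk+nC[k+1]≡[n+1]C[k+1] N K) ⟩
    suc K * (suc N C suc K)                            ∎
    where
    open ≡-Reasoning
    N = suc n
    K = suc k

  C-pos : ∀ {n k} → k ≤ n → 1 ≤ n C k
  C-pos {_} {zero} _ = ≤-refl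
  C-pos {suc n} {suc k} (s≤s k≤n) =
    subst (1 ≤_) (nCk+nC[k+1]≡[n+1]C[k+1] n k) (≤-trans (C-pos k≤n) (m≤m+n _ _))

  C-suc : ∀ n k → n C k ≤ suc n C k
  C-suc n zero = ≤-refl
  C-suc n (suc k) = subst (n C suc k ≤_) (nCk+nC[k+1]≡[n+1]C[k+1] n k) (m≤n+m _ _)

  -- Pascal's rule writes C(2h + 2, h + 1) as a sum of two entries of row 2h + 1, each of which is
  -- at least C(2h, h).
  central-C : ∀ h → 2 ^ h ≤ (h + h) C h
  central-C zero = ≤-refl
  central-C (suc h) = begin
    2 ^ h + (2 ^ h + 0)                            ≡⟨ cong (2 ^ h +_) (+-identityʳ _) ⟩
    2 ^ h + 2 ^ h                                  ≤⟨ +-mono-≤ ih ih ⟩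
    (h + h) C h + (h + h) C h                      ≤⟨ +-mono-≤ (C-suc (h + h) h) (m≤m+n _ _) ⟩
    suc (h + h) C h + ((h + h) C h + (h + h) C suc h) ≡⟨ cong (suc (h + h) C h +_) (nCk+nC[k+1]≡[n+1]C[k+1] (h + h) h) ⟩
    suc (h + h) C h + suc (h + h) C suc h          ≡⟨ nCk+nC[k+1]≡[n+1]C[k+1] (suc (h + h)) h ⟩
    suc (suc (h + h)) C suc h                      ≡⟨ cong (λ z → suc z C suc h) (+-suc h h) ⟨
    (suc h + suc h) C suc h                        ∎
    where
    open ≤-Reasoning
    ih = central-C h

  CommonMultiple : ℕ → ℕ → Set
  CommonMultiple N D = ∀ k → 1 ≤ k → k ≤ N → k ∣ D

  -- Leibniz's harmonic triangle: with X, Y, Z the entries (n + 1) C(n, k + 1), (n + 1) C(n, k)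
  -- and n C(n - 1, k), one has 1/X + 1/Y = 1/Z, so that D/X is an integer if D/Y and D/Z are.
  leibniz-∣ : ∀ {D} n k → k ≤ n → CommonMultiple (suc n) D → suc n * (n C k) ∣ D
  leibniz-∣ {D} n zero _ cm = subst (_∣ D) (sym (*-identityʳ (suc n))) (cm (suc n) (s≤s z≤n) ≤-refl)
  leibniz-∣ {D} (suc n) (suc k) (s≤s k≤n) cm = ∣m+n∣m⇒∣n (divides qZ X-multiple) (n∣m*n qY)
    where
    X = suc (suc n) * (suc n C suc k)
    Y = suc (suc n) * (suc n C k)
    Z = suc n * (n C k)
    Y∣D : Y ∣ D
    Y∣D = leibniz-∣ (suc n) k (m≤n⇒m≤1+n k≤n) cm
    Z∣D : Z ∣ D
    Z∣D = leibniz-∣ n k k≤n (λ j 1≤j j≤n → cm j 1≤j (m≤n⇒m≤1+n j≤n))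
    qY = _∣_.quotient Y∣D
    qZ = _∣_.quotient Z∣D
    instance
      YZ≢0 : NonZero (Y * Z)
      YZ≢0 = >-nonZero (*-mono-≤ {1} {Y} {1} {Z}
        (*-mono-≤ {1} {suc (suc n)} {1} (s≤s z≤n) (C-pos (m≤n⇒m≤1+n k≤n)))
        (*-mono-≤ {1} {suc n} {1} (s≤s z≤n) (C-pos k≤n)))
    X+Y : X + Y ≡ suc (suc n) * (suc (suc n) C suc k)
    X+Y = trans (sym (*-distribˡ-+ (suc (suc n)) (suc n C suc k) (suc n C k)))
      (cong (suc (suc n) *_) (trans (+-comm (suc n C suc k) _) (nCk+nC[k+1]≡[n+1]C[k+1] (suc n) k)))
    XY : X * Y ≡ Z * (X + Y)
    XY = begin
      X * Y                                                         ≡⟨ cong (X *_) (absorption (suc n) k) ⟩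
      (suc (suc n) * (suc n C suc k)) * (suc k * (suc (suc n) C suc k))
        ≡⟨ lemma (suc (suc n)) (suc n C suc k) (suc k) (suc (suc n) C suc k) ⟩
      (suc k * (suc n C suc k)) * (suc (suc n) * (suc (suc n) C suc k)) ≡⟨ cong₂ _*_ (absorption n k) X+Y ⟨
      Z * (X + Y)                                                   ∎
      where
      open ≡-Reasoning
      lemma : ∀ a b c d → (a * b) * (c * d) ≡ (c * b) * (a * d)
      lemma = solve-∀
    -- The relation D/Y + D/X = D/Z multiplied by X, where `qY` and `qZ` are D/Y and D/Z; `XY` is
    -- 1/X + 1/Y = 1/Z cleared of denominators.
    X-multiple : qY * X + D ≡ qZ * X
    X-multiple = *-cancelʳ-≡ _ _ (Y * Z) (begin
      (qY * X + D) * (Y * Z)          ≡⟨ lemma₁ qY X D Y Z ⟩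
      Z * (X * (qY * Y) + D * Y)      ≡⟨ cong (λ d → Z * (X * d + D * Y)) (m∣n⇒n≡quotient*m Y∣D) ⟨
      Z * (X * D + D * Y)             ≡⟨ lemma₂ Z X D Y ⟩
      D * (Z * (X + Y))               ≡⟨ cong₂ _*_ (m∣n⇒n≡quotient*m Z∣D) (sym XY) ⟩
      (qZ * Z) * (X * Y)              ≡⟨ lemma₃ qZ Z X Y ⟩
      (qZ * X) * (Y * Z)              ∎)
      where
      open ≡-Reasoning
      lemma₁ : ∀ q x d y z → (q * x + d) * (y * z) ≡ z * (x * (q * y) + d * y)
      lemma₁ = solve-∀
      lemma₂ : ∀ z x d y → z * (x * d + d * y) ≡ d * (z * (x + y))
      lemma₂ = solve-∀
      lemma₃ : ∀ q z x y → (q * z) * (x * y) ≡ (q * x) * (y * z)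
      lemma₃ = solve-∀

  -- The middle entry (2h + 1) C(2h, h) of Leibniz's triangle divides D and already exceeds the
  -- central binomial coefficient.
  commonMultiple-≥ : ∀ h D → 1 ≤ D → CommonMultiple (suc (h + h)) D → 2 ^ h ≤ D
  commonMultiple-≥ h D 1≤D cm = begin
    2 ^ h                              ≤⟨ central-C h ⟩
    (h + h) C h                        ≤⟨ m≤m+n _ _ ⟩
    suc (h + h) * ((h + h) C h)        ≤⟨ ∣⇒≤ {{>-nonZero 1≤D}} (leibniz-∣ (h + h) h (m≤m+n h h) cm) ⟩
    D                                  ∎
    where open ≤-Reasoning

  maximal-power : ∀ q → 2 ≤ q → ∀ N → 1 ≤ N → ∃ λ e → q ^ e ≤ N × N < q ^ suc e
  maximal-power q 2≤q 1 _ = 0 , ≤-refl , subst (1 <_) (sym (*-identityʳ q)) 2≤q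
  maximal-power q 2≤q (suc N@(suc _)) _ with maximal-power q 2≤q N (s≤s z≤n)
  ... | e , q^e≤N , N<q^e+1 with suc N <? q ^ suc e
  ...   | yes lt = e , m≤n⇒m≤1+n q^e≤N , lt
  -- In this case the new number equals q^(e + 1), and a further factor q ≥ 2 leads beyond it.
  ...   | no ¬lt = suc e , ≮⇒≥ ¬lt , <-≤-trans (s≤s N<q^e+1)
          (≤-trans (+-mono-≤ pos (≤-reflexive (sym (+-identityʳ _)))) (*-monoˡ-≤ (q ^ suc e) 2≤q))
    where
    pos : 1 ≤ q ^ suc e
    pos = m^n>0 q {{>-nonZero (≤-trans (s≤s z≤n) 2≤q)}} (suc e)

  remove-prime : ∀ q → 2 ≤ q → ∀ k → 1 ≤ k → ∃₂ λ i k′ → k ≡ q ^ i * k′ × ¬ q ∣ k′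
  remove-prime q 2≤q = <-rec _ go
    where
    go : ∀ k → (∀ {l} → l < k → 1 ≤ l → ∃₂ λ i k′ → l ≡ q ^ i * k′ × ¬ q ∣ k′) →
         1 ≤ k → ∃₂ λ i k′ → k ≡ q ^ i * k′ × ¬ q ∣ k′
    go k rec 1≤k with q ∣? k
    ... | no q∤k = 0 , k , sym (+-identityʳ k) , q∤k
    ... | yes (divides l refl) with rec {l} l<k 1≤l
      where
      1≤l : 1 ≤ l
      1≤l = n≢0⇒n>0 λ { refl → contradiction 1≤k λ () }
      l<k : l < l * q
      l<k = subst (_< l * q) (*-identityʳ l) (*-monoʳ-< l {{>-nonZero 1≤l}} 2≤q)
    ...   | i , k′ , eq , q∤k′ = suc i , k′ , trans (cong (_* q) eq) (lemma (q ^ i) k′ q) , q∤k′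
      where
      lemma : ∀ a b c → a * b * c ≡ c * a * b
      lemma = solve-∀

  Smooth : ℕ → ℕ → Set
  Smooth m k = ∀ q → Prime q → q ∣ k → q ≤ m

  smooth-0 : ∀ k → 1 ≤ k → Smooth 0 k → k ≡ 1
  smooth-0 k 1≤k smooth = go (factorise k {{>-nonZero 1≤k}})
    where
    go : PrimeFactorisation k → k ≡ 1
    go record { factors = [] ; isFactorisation = eq } = eq
    go record { factors = q ∷ _ ; isFactorisation = eq ; factorsPrime = q-prime ∷ _ } =
      contradiction (smooth q q-prime (subst (q ∣_) (sym eq) (m∣m*n _)))
        (<⇒≱ (<-trans (s≤s z≤n) (nonTrivial⇒n>1 q {{prime⇒nonTrivial q-prime}})))

  -- The witness is the product, over the primes q ≤ m, of the largest power of q that is at most N.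
  -- Each of these at most m factors contributes at most N, and no k ≤ N is divisible by a higher
  -- power of q.
  smooth-multiple : ∀ N → 1 ≤ N → ∀ m → ∃ λ D →
    1 ≤ D × D ≤ N ^ m × (∀ k → 1 ≤ k → k ≤ N → Smooth m k → k ∣ D)
  smooth-multiple N 1≤N zero =
    1 , ≤-refl , ≤-refl , λ k 1≤k _ smooth → subst (_∣ 1) (sym (smooth-0 k 1≤k smooth)) ∣-refl
  smooth-multiple N 1≤N (suc m) with smooth-multiple N 1≤N m | prime? (suc m)
  ... | D , 1≤D , D≤ , multiple | no ¬prime =
    D , 1≤D , ≤-trans D≤ (m≤n*m (N ^ m) N {{>-nonZero 1≤N}}) , λ k 1≤k k≤N smooth →
      multiple k 1≤k k≤N λ q q-prime q∣k →
        s≤s⁻¹ (≤∧≢⇒< (smooth q q-prime q∣k) λ { refl → ¬prime q-prime })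
  ... | D , 1≤D , D≤ , multiple | yes prime-q
      with maximal-power (suc m) 2≤q N 1≤N
    where
    2≤q : 2 ≤ suc m
    2≤q = nonTrivial⇒n>1 (suc m) {{prime⇒nonTrivial prime-q}}
  ...   | e , q^e≤N , N<q^e+1 =
    q ^ e * D , *-mono-≤ {1} {_} {1} (m^n>0 q e) 1≤D , *-mono-≤ q^e≤N D≤ , divide
    where
    q = suc m
    2≤q : 2 ≤ q
    2≤q = nonTrivial⇒n>1 q {{prime⇒nonTrivial prime-q}}
    divide : ∀ k → 1 ≤ k → k ≤ N → Smooth q k → k ∣ q ^ e * D
    divide k 1≤k k≤N smooth with remove-prime q 2≤q k 1≤k
    ... | i , k′ , refl , q∤k′ = *-pres-∣ (m≤n⇒m^o∣n^o i≤e) (multiple k′ 1≤k′ k′≤N smooth′)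
      where
      1≤k′ : 1 ≤ k′
      1≤k′ = n≢0⇒n>0 λ { refl → q∤k′ (q ∣0) }
      k′≤N : k′ ≤ N
      k′≤N = ≤-trans (m≤n*m k′ (q ^ i) {{>-nonZero (m^n>0 q i)}}) k≤N
      q^i≤N : q ^ i ≤ N
      q^i≤N = ≤-trans (m≤m*n (q ^ i) k′ {{>-nonZero 1≤k′}}) k≤N
      i≤e : i ≤ e
      i≤e = ≮⇒≥ λ e<i → <⇒≱ N<q^e+1 (≤-trans (^-monoʳ-≤ q e<i) q^i≤N)
      m≤n⇒m^o∣n^o : ∀ {a b} → a ≤ b → q ^ a ∣ q ^ b
      m≤n⇒m^o∣n^o {a} a≤b = subst (λ z → q ^ a ∣ q ^ z) (m+[n∸m]≡n a≤b)
        (subst (q ^ a ∣_) (sym (^-distribˡ-+-* q a _)) (m∣m*n _))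
      smooth′ : Smooth m k′
      smooth′ r r-prime r∣k′ =
        s≤s⁻¹ (≤∧≢⇒< (smooth r r-prime (∣n⇒∣m*n (q ^ i) r∣k′)) λ { refl → q∤k′ r∣k′ })

  -- If no prime lies in (m, 2h + 1], the numbers up to 2h + 1 are m-smooth and have a common
  -- multiple of size at most (2h + 1)^m.
  prime-between : ∀ m h → suc (h + h) ^ m < 2 ^ h → ∃ λ p → Prime p × m < p × p ≤ suc (h + h)
  prime-between m h small with anyUpTo? (λ p → prime? p ×-dec m <? p) (suc N)
    where N = suc (h + h)
  ... | yes (p , p<N , p-prime , m<p) = p , p-prime , m<p , s≤s⁻¹ p<N
  ... | no none with smooth-multiple (suc (h + h)) (s≤s z≤n) m
  ...   | D , 1≤D , D≤ , multiple = contradiction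
    (commonMultiple-≥ h D 1≤D λ k 1≤k k≤N → multiple k 1≤k k≤N λ q q-prime q∣k →
      ≮⇒≥ λ m<q → none (q , s≤s (≤-trans (∣⇒≤ {{>-nonZero 1≤k}} q∣k) k≤N) , q-prime , m<q))
    (<⇒≱ (≤-<-trans D≤ small))

open PrimeGap

-- Pigeonhole, double counting and greedy covers.

module Counting where

  open import Data.Nat
  open import Data.Nat.Properties
  open ℕ-Ring using (solve-∀)

  private variable
    A B : Set

  -- A pigeonhole principle. A relation takes the place of a function because the partner of an
  -- entry may depend on the proof of its membership. The partner of the head is removed from `ys`;
  -- injectivity ensures that no later entry asks for it.
  length-≤-via : (ρ : A → B → Set) → (∀ {x y z} → ρ x z → ρ y z → x ≡ y) →
    ∀ {xs} ys → Unique xs → (∀ {x} → x ∈ xs → ∃ λ y → y ∈ ys × ρ x y) → length xs ≤ length ys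
  length-≤-via ρ inj {[]} ys _ _ = z≤n
  length-≤-via ρ inj {x ∷ xs} ys (x∉xs ∷ unique) image with image (here refl)
  ... | y , y∈ys , ρxy with ∈-∃++ y∈ys
  ...   | ys₁ , ys₂ , refl = begin
    suc (length xs)                  ≤⟨ s≤s (length-≤-via ρ inj (ys₁ ++ ys₂) unique image′) ⟩
    suc (length (ys₁ ++ ys₂))        ≡⟨ cong suc (length-++ ys₁) ⟩
    suc (length ys₁ + length ys₂)    ≡⟨ +-suc (length ys₁) (length ys₂) ⟨
    length ys₁ + length (y ∷ ys₂)    ≡⟨ length-++ ys₁ ⟨
    length (ys₁ ++ y ∷ ys₂)          ∎
    where
    open ≤-Reasoning
    image′ : ∀ {x′} → x′ ∈ xs → ∃ λ y′ → y′ ∈ ys₁ ++ ys₂ × ρ x′ y′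
    image′ x′∈xs with image (there x′∈xs)
    ... | y′ , y′∈ys , ρx′y′ with ∈-++⁻ ys₁ y′∈ys
    ...   | inj₁ y′∈ys₁ = y′ , ∈-++⁺ˡ y′∈ys₁ , ρx′y′
    ...   | inj₂ (there y′∈ys₂) = y′ , ∈-++⁺ʳ ys₁ y′∈ys₂ , ρx′y′
    ...   | inj₂ (here refl) = contradiction (inj ρxy ρx′y′) (All.lookup x∉xs x′∈xs)

  length-⊆ : ∀ {xs ys : List A} → Unique xs → (∀ {x} → x ∈ xs → x ∈ ys) → length xs ≤ length ys
  length-⊆ {ys = ys} unique sub = length-≤-via _≡_ (λ { refl refl → refl }) ys unique
    λ x∈xs → _ , sub x∈xs , refl

  module Greedy {A : Set} (p : ℕ) .{{_ : NonZero p}}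
    (Bad : Fin p → A → Set) (bad? : ∀ u a → Dec (Bad u a)) where

    badParameters : A → List (Fin p) → List (Fin p)
    badParameters a = filter (λ u → bad? u a)

    remaining : Fin p → List A → List A
    remaining u = filter (bad? u)

    -- Both sums count the pairs of a parameter u and an entry a with `Bad u a`.
    double-counting : ∀ us R →
      sum (map (λ u → length (remaining u R)) us) ≡ sum (map (λ a → length (badParameters a us)) R)
    double-counting [] R = sym (zeros R)
      where
      zeros : ∀ R → sum (map (λ a → length (badParameters a [])) R) ≡ 0
      zeros [] = refl
      zeros (_ ∷ R) = zeros R
    double-counting (u ∷ us) R =
      trans (cong (length (remaining u R) +_) (double-counting us R)) (sym (step R))
      where
      swap : ∀ a b c → a + (b + c) ≡ b + (a + c)
      swap = solve-∀
      step : ∀ R → sum (map (λ a → length (badParameters a (u ∷ us))) R)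
                 ≡ length (remaining u R) + sum (map (λ a → length (badParameters a us)) R)
      step [] = refl
      step (a ∷ R) with bad? u a
      ... | yes _ = cong suc (trans (cong (length (badParameters a us) +_) (step R))
                       (swap (length (badParameters a us)) (length (remaining u R)) _))
      ... | no _ = trans (cong (length (badParameters a us) +_) (step R))
                       (swap (length (badParameters a us)) (length (remaining u R)) _)

    -- The fraction 2/3 leaves room for the bound of 2 + h bad shifts among p = 2h + 1, once h ≥ 4.
    MostlyGood : A → Set
    MostlyGood a = 3 * length (badParameters a (allFin p)) ≤ 2 * p

    sum-upper : ∀ R → (∀ {a} → a ∈ R → MostlyGood a) →
      3 * sum (map (λ a → length (badParameters a (allFin p))) R) ≤ length R * (2 * p)
    sum-upper [] _ = z≤n
    sum-upper (a ∷ R) good = begin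
      3 * (length (badParameters a (allFin p)) + _)   ≡⟨ *-distribˡ-+ 3 (length (badParameters a (allFin p))) _ ⟩
      3 * length (badParameters a (allFin p)) + _     ≤⟨ +-mono-≤ (good (here refl)) (sum-upper R λ a∈R → good (there a∈R)) ⟩
      2 * p + length R * (2 * p)                      ∎
      where open ≤-Reasoning

    sum-lower : ∀ c us R → (∀ u → c ≤ 3 * length (remaining u R)) →
      length us * c ≤ 3 * sum (map (λ u → length (remaining u R)) us)
    sum-lower c [] R _ = z≤n
    sum-lower c (u ∷ us) R large = begin
      c + length us * c                          ≤⟨ +-mono-≤ (large u) (sum-lower c us R large) ⟩
      3 * length (remaining u R) + 3 * rest      ≡⟨ *-distribˡ-+ 3 (length (remaining u R)) rest ⟨
      3 * (length (remaining u R) + rest)        ∎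
      where
      open ≤-Reasoning
      rest = sum (map (λ u → length (remaining u R)) us)

    -- Averaging: if every parameter were bad for more than two thirds of R, there would be more bad
    -- pairs than the two thirds of p allowed to each entry.
    good-parameter : ∀ R → (∀ {a} → a ∈ R → MostlyGood a) →
      ∃ λ u → 3 * length (remaining u R) ≤ 2 * length R
    good-parameter R good with FinP.any? (λ u → 3 * length (remaining u R) ≤? 2 * length R)
    ... | yes found = found
    ... | no none = contradiction (begin-strict
      p * (2 * length R)                               <⟨ *-monoʳ-< p ≤-refl ⟩
      p * suc (2 * length R)                           ≡⟨ cong (_* suc (2 * length R)) (length-tabulate {n = p} (λ i → i)) ⟨
      length (allFin p) * suc (2 * length R)           ≤⟨ sum-lower _ (allFin p) R (λ u → ≰⇒> λ le → none (u , le)) ⟩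
      3 * sum (map (λ u → length (remaining u R)) (allFin p)) ≡⟨ cong (3 *_) (double-counting (allFin p) R) ⟩
      3 * sum (map (λ a → length (badParameters a (allFin p))) R) ≤⟨ sum-upper R good ⟩
      length R * (2 * p)                               ≡⟨ lemma (length R) p ⟩
      p * (2 * length R)                               ∎) (<-irrefl refl)
      where
      open ≤-Reasoning
      lemma : ∀ r p → r * (2 * p) ≡ p * (2 * r)
      lemma = solve-∀

    Covers : ∀ {k} → (Fin k → Fin p) → List A → Set
    Covers f R = ∀ {a} → a ∈ R → ∃ λ i → ¬ Bad (f i) a

    extend-cover : ∀ {k} u (f : Fin k → Fin p) R → Covers f (remaining u R) → Covers (u Vector.∷ f) R
    extend-cover u f R covers {a} a∈R with bad? u a
    ... | no good-u = zero , good-u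
    ... | yes bad-u =
      let (i , good-i) = covers (∈-filter⁺ (bad? u) a∈R bad-u) in suc i , good-i

    -- Each round picks a parameter that is bad for at most two thirds of the entries left, so the
    -- size bound is inherited with k lowered by one. For k = 0 it says that nothing is left.
    greedy-cover : ∀ k R → (∀ {a} → a ∈ R → MostlyGood a) → length R * 2 ^ k < 3 ^ k →
      Σ (Fin k → Fin p) λ f → Covers f R
    greedy-cover zero [] _ _ = (λ ()) , λ ()
    greedy-cover zero (_ ∷ _) _ (s≤s ())
    greedy-cover (suc k) R good small =
      let (u , shrinks) = good-parameter R good
          (f , covers) = greedy-cover k (remaining u R)
            (λ a∈ → good (proj₁ (∈-filter⁻ (bad? u) a∈))) (small′ u shrinks)
      in (u Vector.∷ f) , extend-cover u f R covers
      where
      small′ : ∀ u → 3 * length (remaining u R) ≤ 2 * length R → length (remaining u R) * 2 ^ k < 3 ^ k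
      small′ u shrinks = *-cancelˡ-< 3 _ _ (begin-strict
        3 * (length (remaining u R) * 2 ^ k)   ≡⟨ *-assoc 3 (length (remaining u R)) (2 ^ k) ⟨
        3 * length (remaining u R) * 2 ^ k     ≤⟨ *-monoˡ-≤ (2 ^ k) shrinks ⟩
        2 * length R * 2 ^ k                   ≡⟨ lemma (length R) (2 ^ k) ⟩
        length R * (2 * 2 ^ k)                 <⟨ small ⟩
        3 * 3 ^ k                              ∎)
        where
        open ≤-Reasoning
        lemma : ∀ r t → 2 * r * t ≡ r * (2 * t)
        lemma = solve-∀

open Counting

-- Polarities over F_p and the three excluded configurations.

module PolarGeometry where

  open import Data.Integer using (+_; -_; _+_; _-_; _*_; 0ℤ; 1ℤ)
  open ℤ-Ring using (solve-∀)
  open import Data.Integer.Divisibility.Signed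
    using (_∣_; ∣⇒∣ᵤ; ∣ᵤ⇒∣; ∣m∣n⇒∣m+n; ∣n⇒∣m*n)

  record ℤ³ : Set where
    constructor ⟨_,_,_⟩
    field
      c₁ c₂ c₃ : ℤ
  open ℤ³

  infixl 6 _⊖_
  _⊖_ : ℤ³ → ℤ³ → ℤ³
  x ⊖ y = ⟨ c₁ x - c₁ y , c₂ x - c₂ y , c₃ x - c₃ y ⟩

  module Modular (p : ℕ) (p-prime : Prime p) where

    -- Elements of F_p are represented by integers and "equals 0" by this predicate. An argument in
    -- F_p thus becomes a polynomial identity over ℤ that writes the target as a combination of
    -- vanishing terms.
    V : ℤ → Set
    V e = + p ∣ e

    infixr 5 _⟨+⟩_
    _⟨+⟩_ : ∀ {a b} → V a → V b → V (a + b)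
    _⟨+⟩_ = ∣m∣n⇒∣m+n

    infixr 6 _⟨*⟩_
    _⟨*⟩_ : ∀ r {a} → V a → V (r * a)
    r ⟨*⟩ v = ∣n⇒∣m*n r v

    V-prime : ∀ a b → V (a * b) → V a ⊎ V b
    V-prime a b v = Sum.map ∣ᵤ⇒∣ ∣ᵤ⇒∣
      (euclidsLemma _ _ p-prime (subst (p ℕD.∣_) (ℤP.abs-* a b) (∣⇒∣ᵤ v)))

    V-cancel : ∀ a b → ¬ V a → V (a * b) → V b
    V-cancel a b ¬a v with V-prime a b v
    ... | inj₁ va = ⊥-elim (¬a va)
    ... | inj₂ vb = vb

    V³ : ℤ³ → Set
    V³ v = V (c₁ v) × V (c₂ v) × V (c₃ v)

  module Geometry (p : ℕ) (p-prime : Prime p) (m : ℤ) where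

    open Modular p p-prime

    -- L a₂ a₃ v vanishes when v is parallel to the polar planes of a point with last coordinates a₂, a₃.
    L : ℤ → ℤ → ℤ³ → ℤ
    L a₂ a₃ v = c₁ v + (a₂ * c₂ v + m * (a₃ * c₃ v))

    -- For each shift w and each β the equation B w x y = β is the polarity of a quadric with value
    -- B w x x - β at x, so Q w x y is the value at x of the quadric for which x and y are conjugate.
    B : ℤ × ℤ → ℤ³ → ℤ³ → ℤ
    B (w₂ , w₃) x y = c₁ x + c₁ y + (c₂ x * c₂ y + m * (c₃ x * c₃ y))
                    + (w₂ * (c₂ x + c₂ y) + m * (w₃ * (c₃ x + c₃ y)))

    Λ : ℤ × ℤ → ℤ³ → ℤ³ → ℤ
    Λ (w₂ , w₃) x v = L (c₂ x + w₂) (c₃ x + w₃) v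

    Q : ℤ × ℤ → ℤ³ → ℤ³ → ℤ
    Q w x y = Λ w x (x ⊖ y)

    -- `B w x` is affine in its second argument, with linear part `Λ w x`. Hence if xy and xz have
    -- the same colour, y - z is parallel to the polar planes of x.
    B-diff : ∀ w x y z → Λ w x (y ⊖ z) ≡ B w x y - B w x z
    B-diff (w₂ , w₃) ⟨ x₁ , x₂ , x₃ ⟩ ⟨ y₁ , y₂ , y₃ ⟩ ⟨ z₁ , z₂ , z₃ ⟩ =
      lemma m w₂ w₃ x₁ x₂ x₃ y₁ y₂ y₃ z₁ z₂ z₃
      where
      lemma : ∀ m w₂ w₃ x₁ x₂ x₃ y₁ y₂ y₃ z₁ z₂ z₃ →
        (y₁ - z₁) + ((x₂ + w₂) * (y₂ - z₂) + m * ((x₃ + w₃) * (y₃ - z₃)))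
        ≡ (x₁ + y₁ + (x₂ * y₂ + m * (x₃ * y₃)) + (w₂ * (x₂ + y₂) + m * (w₃ * (x₃ + y₃))))
        - (x₁ + z₁ + (x₂ * z₂ + m * (x₃ * z₃)) + (w₂ * (x₂ + z₂) + m * (w₃ * (x₃ + z₃))))
      lemma = solve-∀

    norm : ℤ³ → ℤ
    norm v = c₂ v * c₂ v + m * (c₃ v * c₃ v)

    -- The sum of Q(x;y) and Q(y;x) is the same for all shifts. With t = Q(x;y) their product is t
    -- (N - t) for a fixed N, which makes it possible to count the bad shifts.
    Q-sum : ∀ w x y → Q w y x ≡ norm (x ⊖ y) - Q w x y
    Q-sum (w₂ , w₃) ⟨ x₁ , x₂ , x₃ ⟩ ⟨ y₁ , y₂ , y₃ ⟩ = lemma m w₂ w₃ x₁ x₂ x₃ y₁ y₂ y₃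
      where
      lemma : ∀ m w₂ w₃ x₁ x₂ x₃ y₁ y₂ y₃ →
        (y₁ - x₁) + ((y₂ + w₂) * (y₂ - x₂) + m * ((y₃ + w₃) * (y₃ - x₃)))
        ≡ (x₂ - y₂) * (x₂ - y₂) + m * ((x₃ - y₃) * (x₃ - y₃))
        - ((x₁ - y₁) + ((x₂ + w₂) * (x₂ - y₂) + m * ((x₃ + w₃) * (x₃ - y₃))))
      lemma = solve-∀

    -- On directions parallel to a polar plane the first coordinate is a linear function of the
    -- other two.
    direction-≢0 : ∀ a₂ a₃ v → V (L a₂ a₃ v) → ¬ V³ v → ¬ (V (c₂ v) × V (c₃ v))
    direction-≢0 a₂ a₃ ⟨ v₁ , v₂ , v₃ ⟩ Lv v≢0 (Vv₂ , Vv₃) =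
      v≢0 (subst V (sym (lemma m a₂ a₃ v₁ v₂ v₃))
             (Lv ⟨+⟩ - a₂ ⟨*⟩ Vv₂ ⟨+⟩ - (m * a₃) ⟨*⟩ Vv₃)
          , Vv₂ , Vv₃)
      where
      lemma : ∀ m a₂ a₃ v₁ v₂ v₃ →
        v₁ ≡ (v₁ + (a₂ * v₂ + m * (a₃ * v₃))) + (- a₂ * v₂ + - (m * a₃) * v₃)
      lemma = solve-∀

    -- A good pair is one whose polar line misses the quadric.
    Good : ℤ × ℤ → ℤ³ → ℤ³ → Set
    Good w x y = ∀ z → ¬ V (z * z - m * (Q w x y * Q w y x))

    -- If Q(x;y) vanished, the product in `Good` would be the square of z = 0.
    good⇒Q≢0 : ∀ {w x y} → Good w x y → ¬ V (Q w x y)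
    good⇒Q≢0 {w} {x} {y} good VQ =
      good 0ℤ (subst V (lemma m (Q w x y) (Q w y x)) ((- (m * Q w y x)) ⟨*⟩ VQ))
      where
      lemma : ∀ m q r → - (m * r) * q ≡ 0ℤ * 0ℤ - m * (q * r)
      lemma = solve-∀

    record Same (w : ℤ × ℤ) (x y z : ℤ³) : Set where
      constructor same
      field V-diff : V (B w x y - B w x z)

    same⇒Λ : ∀ {w x} y z → Same w x y z → V (Λ w x (y ⊖ z))
    same⇒Λ {w} {x} y z (same v) = subst V (sym (B-diff w x y z)) v

    module _ (m≢0 : ¬ V m) where

      module _ (a₂ a₃ b₂ b₃ d₂ d₃ : ℤ) (Γ Δ : ℤ³)
               (aΓ : V (L a₂ a₃ Γ)) (aΔ : V (L a₂ a₃ Δ))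
               (bΓ : V (L b₂ b₃ Γ)) (bΔ : V (L b₂ b₃ Δ))
               (dΓ : V (L d₂ d₃ Γ)) (¬dΔ : ¬ V (L d₂ d₃ Δ)) (Γ≢0 : ¬ V³ Γ) where

        private
          open ℤ³ Γ renaming (c₁ to g₁; c₂ to g₂; c₃ to g₃)
          open ℤ³ Δ renaming (c₁ to e₁; c₂ to e₂; c₃ to e₃)

          det : ℤ
          det = g₂ * e₃ - g₃ * e₂

          -- If `det` vanished, Γ and Δ would be dependent. As `L d₂ d₃` vanishes at Γ and not at Δ,
          -- this makes g₂ and g₃ vanish, and then Γ.
          not-collinear : ¬ V det
          not-collinear Vdet = direction-≢0 a₂ a₃ Γ aΓ Γ≢0 (coord g₂ lem₂ , coord g₃ lem₃)
            where
            coord : ∀ g → V (g * L d₂ d₃ Δ) → V g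
            coord g v with V-prime g (L d₂ d₃ Δ) v
            ... | inj₁ Vg = Vg
            ... | inj₂ Vd = ⊥-elim (¬dΔ Vd)
            id₂ : ∀ m a₂ a₃ d₂ d₃ g₁ g₂ g₃ e₁ e₂ e₃ →
              g₂ * (e₁ + (d₂ * e₂ + m * (d₃ * e₃)))
              ≡ e₂ * (g₁ + (d₂ * g₂ + m * (d₃ * g₃)))
              + (g₂ * (e₁ + (a₂ * e₂ + m * (a₃ * e₃)))
              + (- e₂ * (g₁ + (a₂ * g₂ + m * (a₃ * g₃)))
              + m * (d₃ - a₃) * (g₂ * e₃ - g₃ * e₂)))
            id₂ = solve-∀
            id₃ : ∀ m a₂ a₃ d₂ d₃ g₁ g₂ g₃ e₁ e₂ e₃ →
              g₃ * (e₁ + (d₂ * e₂ + m * (d₃ * e₃)))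
              ≡ e₃ * (g₁ + (d₂ * g₂ + m * (d₃ * g₃)))
              + (g₃ * (e₁ + (a₂ * e₂ + m * (a₃ * e₃)))
              + (- e₃ * (g₁ + (a₂ * g₂ + m * (a₃ * g₃)))
              + (a₂ - d₂) * (g₂ * e₃ - g₃ * e₂)))
            id₃ = solve-∀
            lem₂ : V (g₂ * L d₂ d₃ Δ)
            lem₂ = subst V (sym (id₂ m a₂ a₃ d₂ d₃ g₁ g₂ g₃ e₁ e₂ e₃))
              (e₂ ⟨*⟩ dΓ ⟨+⟩ g₂ ⟨*⟩ aΔ ⟨+⟩ - e₂ ⟨*⟩ aΓ ⟨+⟩ (m * (d₃ - a₃)) ⟨*⟩ Vdet)
            lem₃ : V (g₃ * L d₂ d₃ Δ)
            lem₃ = subst V (sym (id₃ m a₂ a₃ d₂ d₃ g₁ g₂ g₃ e₁ e₂ e₃))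
              (e₃ ⟨*⟩ dΓ ⟨+⟩ g₃ ⟨*⟩ aΔ ⟨+⟩ - e₃ ⟨*⟩ aΓ ⟨+⟩ (a₂ - d₂) ⟨*⟩ Vdet)

        -- Γ and Δ are independent, since the polar planes of d are parallel to Γ but not to Δ, and
        -- two independent directions determine a family of parallel planes. The coordinates are
        -- compared by Cramer's rule.
        same-plane : V (a₂ - b₂) × V (a₃ - b₃)
        same-plane =
            V-cancel det _ not-collinear
              (subst V (sym (id₂ m a₂ a₃ b₂ b₃ g₁ g₂ g₃ e₁ e₂ e₃))
                (e₃ ⟨*⟩ aΓ ⟨+⟩ - e₃ ⟨*⟩ bΓ ⟨+⟩ - g₃ ⟨*⟩ aΔ ⟨+⟩ g₃ ⟨*⟩ bΔ))
          , V-cancel m _ m≢0 (V-cancel det _ not-collinear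
              (subst V (sym (id₃ m a₂ a₃ b₂ b₃ g₁ g₂ g₃ e₁ e₂ e₃))
                (- e₂ ⟨*⟩ aΓ ⟨+⟩ e₂ ⟨*⟩ bΓ ⟨+⟩ g₂ ⟨*⟩ aΔ ⟨+⟩ - g₂ ⟨*⟩ bΔ)))
          where
          id₂ : ∀ m a₂ a₃ b₂ b₃ g₁ g₂ g₃ e₁ e₂ e₃ →
            (g₂ * e₃ - g₃ * e₂) * (a₂ - b₂)
            ≡ e₃ * (g₁ + (a₂ * g₂ + m * (a₃ * g₃)))
            + (- e₃ * (g₁ + (b₂ * g₂ + m * (b₃ * g₃)))
            + (- g₃ * (e₁ + (a₂ * e₂ + m * (a₃ * e₃)))
            + g₃ * (e₁ + (b₂ * e₂ + m * (b₃ * e₃)))))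
          id₂ = solve-∀
          id₃ : ∀ m a₂ a₃ b₂ b₃ g₁ g₂ g₃ e₁ e₂ e₃ →
            (g₂ * e₃ - g₃ * e₂) * (m * (a₃ - b₃))
            ≡ - e₂ * (g₁ + (a₂ * g₂ + m * (a₃ * g₃)))
            + (e₂ * (g₁ + (b₂ * g₂ + m * (b₃ * g₃)))
            + (g₂ * (e₁ + (a₂ * e₂ + m * (a₃ * e₃)))
            + - g₂ * (e₁ + (b₂ * e₂ + m * (b₃ * e₃)))))
          id₃ = solve-∀

      -- Two distinct polar planes meet in at most a line, and a good edge keeps c off the line de.
      no-caterpillar : ∀ {u v w a b c d e} → ¬ V³ (d ⊖ e) →
        Same u a b c → Same u a c d → Same u a d e →
        Same v b c d → Same v b d e → Good v b c →
        Same w c d e → Good w c d → ⊥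
      no-caterpillar {u₂ , u₃} {v₂ , v₃} {w₂ , w₃} {a} {b} {c} {d} {e}
        d≢e abc acd ade bcd bde good-bc cde good-cd =
        good⇒Q≢0 {v₂ , v₃} {b} {c} good-bc
          (subst V (sym (lemma m (c₂ a + u₂) (c₃ a + u₃) (c₂ b + v₂) (c₃ b + v₃) (c₁ bc) (c₂ bc) (c₃ bc)))
            (same⇒Λ b c abc ⟨+⟩ - c₂ bc ⟨*⟩ proj₁ planes ⟨+⟩ - (m * c₃ bc) ⟨*⟩ proj₂ planes))
        where
        bc = b ⊖ c
        planes = same-plane (c₂ a + u₂) (c₃ a + u₃) (c₂ b + v₂) (c₃ b + v₃) (c₂ c + w₂) (c₃ c + w₃)
          (d ⊖ e) (c ⊖ d) (same⇒Λ d e ade) (same⇒Λ c d acd)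
          (same⇒Λ d e bde) (same⇒Λ c d bcd) (same⇒Λ d e cde)
          (good⇒Q≢0 {w₂ , w₃} {c} {d} good-cd) d≢e
        lemma : ∀ m a₂ a₃ b₂ b₃ e₁ e₂ e₃ →
          e₁ + (b₂ * e₂ + m * (b₃ * e₃))
          ≡ (e₁ + (a₂ * e₂ + m * (a₃ * e₃))) + (- e₂ * (a₂ - b₂) + - (m * e₃) * (a₃ - b₃))
        lemma = solve-∀

      -- The polar planes of a and b share the directions d - e and c - d, which are independent
      -- because cd is good and cd, ce have the same colour. So a and b agree in the last two
      -- coordinates, and since a - b is parallel to a polar plane of c, also in the first.
      no-K₂₃ : ∀ {v w a b c d e} → ¬ V³ (a ⊖ b) → ¬ V³ (d ⊖ e) →
        Same v a c d → Same v a d e → Same v b c d → Same v b d e → Same v c a b →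
        Same w c d e → Good w c d → ⊥
      no-K₂₃ {v₂ , v₃} {w₂ , w₃} {a} {b} {c} {d} {e}
        a≢b d≢e acd ade bcd bde cab cde good-cd =
        direction-≢0 (c₂ c + v₂) (c₃ c + v₃) (a ⊖ b) (same⇒Λ a b cab) a≢b
          ( subst V (lemma (c₂ a) (c₂ b) v₂) (proj₁ planes)
          , subst V (lemma (c₃ a) (c₃ b) v₃) (proj₂ planes))
        where
        planes = same-plane (c₂ a + v₂) (c₃ a + v₃) (c₂ b + v₂) (c₃ b + v₃) (c₂ c + w₂) (c₃ c + w₃)
          (d ⊖ e) (c ⊖ d) (same⇒Λ d e ade) (same⇒Λ c d acd)
          (same⇒Λ d e bde) (same⇒Λ c d bcd) (same⇒Λ d e cde)
          (good⇒Q≢0 {w₂ , w₃} {c} {d} good-cd) d≢e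
        lemma : ∀ a b v → (a + v) - (b + v) ≡ a - b
        lemma = solve-∀

      -- The polar lines bc and de span the plane of a, hence meet. Projected to the last two
      -- coordinates, with f and g the differences of b and d from the centre of a, this
      -- forces ⟨f , g⟩ = 0, Q(b;d) = N(f) and Q(d;b) = N(g), and then
      -- m N(f) N(g) = m ⟨f , g⟩² + (m (f₂ g₃ - f₃ g₂))² is a square.
      no-coned-C₄ : ∀ {u v a b c d e} → ¬ V³ (b ⊖ c) → ¬ V³ (d ⊖ e) →
        Same u a b c → Same u a b d → Same u a d e →
        Same v b d e → Same v c d e → Same v d b c → Good v b d → ⊥
      no-coned-C₄ {u₂ , u₃} {v₂ , v₃} {a} {b} {c} {d} {e}
        b≢c d≢e abc abd ade bde cde dbc good-bd =
        good-bd (m * (f₂ * g₃ - f₃ * g₂)) (subst V (sym (id-square m f₂ f₃ g₂ g₃ (Q v b d) (Q v d b)))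
          ((- (m * f·g)) ⟨*⟩ V-f·g ⟨+⟩ (- (m * Q v d b)) ⟨*⟩ V-Qbd ⟨+⟩ (- (m * (f₂ * f₂ + m * (f₃ * f₃)))) ⟨*⟩ V-Qdb))
        where
        v : ℤ × ℤ
        v = v₂ , v₃
        a₂ = c₂ a + u₂
        a₃ = c₃ a + u₃
        f₂ = c₂ b + v₂ - a₂
        f₃ = c₃ b + v₃ - a₃
        g₂ = c₂ d + v₂ - a₂
        g₃ = c₃ d + v₃ - a₃
        f·g = f₂ * g₂ + m * (f₃ * g₃)
        Γ = d ⊖ e
        Δ = b ⊖ c
        aΓ : V (L a₂ a₃ Γ)
        aΓ = same⇒Λ d e ade
        aΔ : V (L a₂ a₃ Δ)
        aΔ = same⇒Λ b c abc
        bΓ : V (Λ v b Γ)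
        bΓ = same⇒Λ d e bde
        cΓ : V (Λ v c Γ)
        cΓ = same⇒Λ d e cde
        dΔ : V (Λ v d Δ)
        dΔ = same⇒Λ b c dbc
        id-diff : ∀ m x₂ x₃ a₂ a₃ v₁ v₂ v₃ →
          (x₂ - a₂) * v₂ + m * ((x₃ - a₃) * v₃)
          ≡ (v₁ + (x₂ * v₂ + m * (x₃ * v₃))) + - (+ 1) * (v₁ + (a₂ * v₂ + m * (a₃ * v₃)))
        id-diff = solve-∀
        f·Γ : V (f₂ * c₂ Γ + m * (f₃ * c₃ Γ))
        f·Γ = subst V (sym (id-diff m (c₂ b + v₂) (c₃ b + v₃) a₂ a₃ (c₁ Γ) (c₂ Γ) (c₃ Γ)))
          (bΓ ⟨+⟩ - (+ 1) ⟨*⟩ aΓ)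
        g·Δ : V (g₂ * c₂ Δ + m * (g₃ * c₃ Δ))
        g·Δ = subst V (sym (id-diff m (c₂ d + v₂) (c₃ d + v₃) a₂ a₃ (c₁ Δ) (c₂ Δ) (c₃ Δ)))
          (dΔ ⟨+⟩ - (+ 1) ⟨*⟩ aΔ)
        Δ·Γ : V (c₂ Δ * c₂ Γ + m * (c₃ Δ * c₃ Γ))
        Δ·Γ = subst V (sym (lemma m (c₂ b) (c₃ b) (c₂ c) (c₃ c) v₂ v₃ (c₁ Γ) (c₂ Γ) (c₃ Γ)))
          (bΓ ⟨+⟩ - (+ 1) ⟨*⟩ cΓ)
          where
          lemma : ∀ m b₂ b₃ c₂ c₃ v₂ v₃ g₁ g₂ g₃ →
            (b₂ - c₂) * g₂ + m * ((b₃ - c₃) * g₃)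
            ≡ (g₁ + ((b₂ + v₂) * g₂ + m * ((b₃ + v₃) * g₃)))
            + - (+ 1) * (g₁ + ((c₂ + v₂) * g₂ + m * ((c₃ + v₃) * g₃)))
          lemma = solve-∀
        split : ∀ {r s t} → V (r * t) → V (s * t) → ¬ (V r × V s) → V t
        split {r} {s} {t} Vrt Vst ¬rs with V-prime r t Vrt
        ... | inj₂ Vt = Vt
        ... | inj₁ Vr with V-prime s t Vst
        ...   | inj₂ Vt = Vt
        ...   | inj₁ Vs = ⊥-elim (¬rs (Vr , Vs))
        -- In the projection f and Δ are both orthogonal to Γ ≠ 0, hence parallel. As g is
        -- orthogonal to Δ ≠ 0, it is then orthogonal to f as well.
        V-f×Δ : V (f₂ * c₃ Δ - f₃ * c₂ Δ)
        V-f×Δ = split {c₂ Γ} {c₃ Γ}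
          (subst V (sym (id₂ m f₂ f₃ (c₂ Γ) (c₃ Γ) (c₂ Δ) (c₃ Δ)))
            (c₃ Δ ⟨*⟩ f·Γ ⟨+⟩ - f₃ ⟨*⟩ Δ·Γ))
          (V-cancel m _ m≢0 (subst V (sym (id₃ m f₂ f₃ (c₂ Γ) (c₃ Γ) (c₂ Δ) (c₃ Δ)))
            (f₂ ⟨*⟩ Δ·Γ ⟨+⟩ - c₂ Δ ⟨*⟩ f·Γ)))
          (direction-≢0 a₂ a₃ Γ aΓ d≢e)
          where
          id₂ : ∀ m f₂ f₃ g₂ g₃ e₂ e₃ → g₂ * (f₂ * e₃ - f₃ * e₂)
            ≡ e₃ * (f₂ * g₂ + m * (f₃ * g₃)) + - f₃ * (e₂ * g₂ + m * (e₃ * g₃))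
          id₂ = solve-∀
          id₃ : ∀ m f₂ f₃ g₂ g₃ e₂ e₃ → m * (g₃ * (f₂ * e₃ - f₃ * e₂))
            ≡ f₂ * (e₂ * g₂ + m * (e₃ * g₃)) + - e₂ * (f₂ * g₂ + m * (f₃ * g₃))
          id₃ = solve-∀
        V-f·g : V f·g
        V-f·g = split {c₂ Δ} {c₃ Δ}
          (subst V (sym (id₂ m f₂ f₃ g₂ g₃ (c₂ Δ) (c₃ Δ)))
            (f₂ ⟨*⟩ g·Δ ⟨+⟩ - (m * g₃) ⟨*⟩ V-f×Δ))
          (subst V (sym (id₃ m f₂ f₃ g₂ g₃ (c₂ Δ) (c₃ Δ)))
            (f₃ ⟨*⟩ g·Δ ⟨+⟩ g₂ ⟨*⟩ V-f×Δ))
          (direction-≢0 a₂ a₃ Δ aΔ b≢c)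
          where
          id₂ : ∀ m f₂ f₃ g₂ g₃ e₂ e₃ → e₂ * (f₂ * g₂ + m * (f₃ * g₃))
            ≡ f₂ * (g₂ * e₂ + m * (g₃ * e₃)) + - (m * g₃) * (f₂ * e₃ - f₃ * e₂)
          id₂ = solve-∀
          id₃ : ∀ m f₂ f₃ g₂ g₃ e₂ e₃ → e₃ * (f₂ * g₂ + m * (f₃ * g₃))
            ≡ f₃ * (g₂ * e₂ + m * (g₃ * e₃)) + g₂ * (f₂ * e₃ - f₃ * e₂)
          id₃ = solve-∀
        -- Q(b;d) is N(f) - ⟨f , g⟩ plus the linear form of a at b - d, and this form vanishes there
        -- because ab and ad have the same colour.
        V-Qbd : V (Q v b d - (f₂ * f₂ + m * (f₃ * f₃)))
        V-Qbd = subst V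
          (sym (lemma m (c₁ b) (c₂ b) (c₃ b) (c₁ d) (c₂ d) (c₃ d) v₂ v₃ a₂ a₃))
          (same⇒Λ b d abd ⟨+⟩ - (+ 1) ⟨*⟩ V-f·g)
          where
          lemma : ∀ m b₁ b₂ b₃ d₁ d₂ d₃ v₂ v₃ a₂ a₃ →
            ((b₁ - d₁) + ((b₂ + v₂) * (b₂ - d₂) + m * ((b₃ + v₃) * (b₃ - d₃))))
              - ((b₂ + v₂ - a₂) * (b₂ + v₂ - a₂) + m * ((b₃ + v₃ - a₃) * (b₃ + v₃ - a₃)))
            ≡ ((b₁ - d₁) + (a₂ * (b₂ - d₂) + m * (a₃ * (b₃ - d₃))))
            + - (+ 1) * ((b₂ + v₂ - a₂) * (d₂ + v₂ - a₂) + m * ((b₃ + v₃ - a₃) * (d₃ + v₃ - a₃)))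
          lemma = solve-∀
        V-Qdb : V (Q v d b - (g₂ * g₂ + m * (g₃ * g₃)))
        V-Qdb = subst V
          (sym (lemma m (c₁ b) (c₂ b) (c₃ b) (c₁ d) (c₂ d) (c₃ d) v₂ v₃ a₂ a₃))
          (- (+ 1) ⟨*⟩ same⇒Λ b d abd ⟨+⟩ - (+ 1) ⟨*⟩ V-f·g)
          where
          lemma : ∀ m b₁ b₂ b₃ d₁ d₂ d₃ v₂ v₃ a₂ a₃ →
            ((d₁ - b₁) + ((d₂ + v₂) * (d₂ - b₂) + m * ((d₃ + v₃) * (d₃ - b₃))))
              - ((d₂ + v₂ - a₂) * (d₂ + v₂ - a₂) + m * ((d₃ + v₃ - a₃) * (d₃ + v₃ - a₃)))
            ≡ - (+ 1) * ((b₁ - d₁) + (a₂ * (b₂ - d₂) + m * (a₃ * (b₃ - d₃))))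
            + - (+ 1) * ((b₂ + v₂ - a₂) * (d₂ + v₂ - a₂) + m * ((b₃ + v₃ - a₃) * (d₃ + v₃ - a₃)))
          lemma = solve-∀
        id-square : ∀ m f₂ f₃ g₂ g₃ q r →
          (m * (f₂ * g₃ - f₃ * g₂)) * (m * (f₂ * g₃ - f₃ * g₂)) - m * (q * r)
          ≡ - (m * (f₂ * g₂ + m * (f₃ * g₃))) * (f₂ * g₂ + m * (f₃ * g₃))
          + (- (m * r) * (q - (f₂ * f₂ + m * (f₃ * f₃)))
          + - (m * (f₂ * f₂ + m * (f₃ * f₃))) * (r - (g₂ * g₂ + m * (g₃ * g₃))))
        id-square = solve-∀

open PolarGeometry

-- Residues, inverses, squares and non-squares modulo an odd prime.

module ModularArithmetic where

  open import Data.Integer using (+_; -_; _+_; _-_; _*_; 0ℤ; 1ℤ)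
  open ℤ-Ring using (solve-∀)
  open import Data.Integer.DivMod using (_%ℕ_; _/ℕ_; n%ℕd<d; a≡a%ℕn+[a/ℕn]*n)
  open import Data.Integer.Divisibility.Signed using (_∣?_; divides; ∣⇒∣ᵤ; ∣m⇒∣-m)

  parity : ∀ n → ∃ λ h → n ≡ h ℕ.+ h ⊎ n ≡ ℕ.suc (h ℕ.+ h)
  parity ℕ.zero = 0 , inj₁ refl
  parity (ℕ.suc n) with parity n
  ... | h , inj₁ eq = h , inj₂ (cong ℕ.suc eq)
  ... | h , inj₂ eq = ℕ.suc h , inj₁ (cong ℕ.suc (trans eq (sym (ℕP.+-suc h h))))

  odd-prime : ∀ {p} → Prime p → 2 ℕ.< p → ∃ λ h → p ≡ ℕ.suc (h ℕ.+ h)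
  odd-prime {p} p-prime 2<p with parity p
  ... | h , inj₂ eq = h , eq
  ... | h , inj₁ eq = contradiction
    (composite 2<p (ℕD.divides h (trans eq (lemma h))))
    (Prime.notComposite p-prime)
    where
    lemma : ∀ h → h ℕ.+ h ≡ h ℕ.* 2
    lemma h = sym (trans (ℕP.*-comm h 2) (cong (h ℕ.+_) (ℕP.+-identityʳ h)))

  ⌊_⌋ : ∀ {n} → Fin n → ℤ
  ⌊ i ⌋ = + toℕ i

  module Residues (p : ℕ) (p-prime : Prime p) where

    open Modular p p-prime

    instance
      p≢0 : NonZero p
      p≢0 = prime⇒nonZero p-prime

    V? : ∀ e → Dec (V e)
    V? e = + p ∣? e

    V-neg : ∀ a b → V (a - b) → V (b - a)
    V-neg a b v = subst V (lemma a b) (∣m⇒∣-m v)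
      where
      lemma : ∀ a b → - (a - b) ≡ b - a
      lemma = solve-∀

    residue : ∀ y → ∃ λ (r : Fin p) → V (y - ⌊ r ⌋)
    residue y = fromℕ< (n%ℕd<d y p) ,
      subst (λ r → V (y - + r)) (sym (FinP.toℕ-fromℕ< (n%ℕd<d y p)))
        (divides (y /ℕ p) (trans (cong (_- + (y %ℕ p)) (a≡a%ℕn+[a/ℕn]*n y p)) (lemma (+ (y %ℕ p)) (y /ℕ p * + p))))
      where
      lemma : ∀ r q → r + q - r ≡ q
      lemma = solve-∀

    V-small : ∀ {a b} → a ℕ.≤ b → b ℕ.< p → V (+ b - + a) → a ≡ b
    V-small {a} {b} a≤b b<p v with ℕP.m≤n⇒m<n∨m≡n a≤b
    ... | inj₂ a≡b = a≡b
    ... | inj₁ a<b = contradiction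
      (∣⇒∣ᵤ (subst V (trans (ℤP.m-n≡m⊖n b a) (ℤP.⊖-≥ a≤b)) v))
      (ℕD.>⇒∤ {{ℕ.>-nonZero (ℕP.m<n⇒0<n∸m a<b)}} (ℕP.≤-<-trans (ℕP.m∸n≤m b a) b<p))

    V-Fin-injective : ∀ (i j : Fin p) → V (⌊ i ⌋ - ⌊ j ⌋) → i ≡ j
    V-Fin-injective i j v with ℕP.≤-total (toℕ i) (toℕ j)
    ... | inj₁ i≤j = FinP.toℕ-injective (V-small i≤j (FinP.toℕ<n j) (V-neg ⌊ i ⌋ ⌊ j ⌋ v))
    ... | inj₂ j≤i = sym (FinP.toℕ-injective (V-small j≤i (FinP.toℕ<n i) v))

    inverse : ∀ v → ¬ V v → ∃ λ v′ → V (v * v′ - 1ℤ)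
    inverse v ¬Vv with residue v
    ... | r , v≡r = fromBézout (coprime-Bézout (prime⇒coprime p-prime {{ℕ.≢-nonZero r≢0}} (FinP.toℕ<n r)))
      where
      r≢0 : toℕ r ≢ 0
      r≢0 r≡0 = ¬Vv (subst V (trans (cong (λ z → v - + z) r≡0) (ℤP.+-identityʳ v)) v≡r)
      fromBézout : Bézout.Identity 1 p (toℕ r) → ∃ λ v′ → V (v * v′ - 1ℤ)
      fromBézout (Bézout.+- x y eq) = - + y , subst V (sym (lemma v ⌊ r ⌋ (+ y)))
          ((- + y) ⟨*⟩ v≡r ⟨+⟩ divides (- + x) (trans (cong -_ eqℤ) (ℤP.neg-distribˡ-* (+ x) (+ p))))
        where
        eqℤ : 1ℤ + + y * ⌊ r ⌋ ≡ + x * + p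
        eqℤ = trans (cong (λ e → 1ℤ + e) (sym (ℤP.pos-* y (toℕ r)))) (trans (cong +_ eq) (ℤP.pos-* x p))
        lemma : ∀ v r y → v * - y - 1ℤ ≡ - y * (v - r) + - (1ℤ + y * r)
        lemma = solve-∀
      fromBézout (Bézout.-+ x y eq) = + y , subst V (sym (lemma v ⌊ r ⌋ (+ y) (+ x * + p) eqℤ))
          ((+ y) ⟨*⟩ v≡r ⟨+⟩ divides (+ x) refl)
        where
        eqℤ : 1ℤ + + x * + p ≡ + y * ⌊ r ⌋
        eqℤ = trans (cong (λ e → 1ℤ + e) (sym (ℤP.pos-* x p))) (trans (cong +_ eq) (ℤP.pos-* y (toℕ r)))
        lemma′ : ∀ v r y → v * y - 1ℤ ≡ y * (v - r) + (y * r - 1ℤ)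
        lemma′ = solve-∀
        cancel : ∀ a → (1ℤ + a) - 1ℤ ≡ a
        cancel = solve-∀
        lemma : ∀ v r y a → 1ℤ + a ≡ y * r → v * y - 1ℤ ≡ y * (v - r) + a
        lemma v r y a eq = trans (lemma′ v r y)
          (cong (λ e → y * (v - r) + e) (trans (cong (_- 1ℤ) (sym eq)) (cancel a)))

    module _ (h : ℕ) (p≡1+2h : p ≡ ℕ.suc (h ℕ.+ h)) where

      -- Of the residue r of y and p - r, which have the same square, one is at most h.
      half-square : ∀ y → ∃ λ (i : Fin (ℕ.suc h)) → V (y * y - ⌊ i ⌋ * ⌊ i ⌋)
      half-square y with residue y
      ... | r , y≡r with toℕ r ℕ.≤? h
      ...   | yes r≤h = fromℕ< (s≤s r≤h) ,
        subst (λ i → V (y * y - + i * + i)) (sym (FinP.toℕ-fromℕ< (s≤s r≤h)))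
          (subst V (lemma y ⌊ r ⌋) ((y + ⌊ r ⌋) ⟨*⟩ y≡r))
        where
        lemma : ∀ y r → (y + r) * (y - r) ≡ y * y - r * r
        lemma = solve-∀
      ...   | no r≰h = fromℕ< (s≤s i≤h) ,
        subst (λ i → V (y * y - + i * + i)) (sym (FinP.toℕ-fromℕ< (s≤s i≤h)))
          (subst V (lemma y (+ i)) ((y - + i) ⟨*⟩
            subst V (trans (lemma′ y ⌊ r ⌋ (+ p)) (cong (λ e → y + e) p-r)) (y≡r ⟨+⟩ divides 1ℤ (sym (ℤP.*-identityˡ (+ p))))))
        where
        i = p ℕ.∸ toℕ r
        i≤h : i ℕ.≤ h
        i≤h = ℕP.m≤n+o⇒m∸n≤o p (toℕ r) (ℕP.≤-trans (ℕP.≤-reflexive p≡1+2h) (ℕP.+-monoˡ-≤ h (ℕP.≰⇒> r≰h)))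
        p-r : + p - ⌊ r ⌋ ≡ + i
        p-r = trans (ℤP.m-n≡m⊖n p (toℕ r)) (ℤP.⊖-≥ (ℕP.<⇒≤ (FinP.toℕ<n r)))
        lemma : ∀ y i → (y - i) * (y + i) ≡ y * y - i * i
        lemma = solve-∀
        lemma′ : ∀ y r p → (y - r) + p ≡ y + (p - r)
        lemma′ = solve-∀

      -- By `half-square` there are at most h + 1 squares, fewer than the 2h + 1 residues; if all
      -- residues had roots, `half` would contradict the pigeonhole principle.
      nonresidue : 1 ℕ.≤ h → ∃ λ η → ∀ z → ¬ V (z * z - η)
      nonresidue 1≤h with FinP.any? (λ (η : Fin p) → ¬? (FinP.any? λ (z : Fin p) → V? (⌊ z ⌋ * ⌊ z ⌋ - ⌊ η ⌋)))
      ... | yes (η , no-root) = ⌊ η ⌋ , λ z v →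
        no-root (proj₁ (residue z) , subst V (lemma z ⌊ proj₁ (residue z) ⌋ ⌊ η ⌋)
          (v ⟨+⟩ (- (z + ⌊ proj₁ (residue z) ⌋)) ⟨*⟩ proj₂ (residue z)))
        where
        lemma : ∀ z r η → (z * z - η) + - (z + r) * (z - r) ≡ r * r - η
        lemma = solve-∀
      ... | no all-roots = contradiction (FinP.injective⇒≤ {f = half} half-injective)
          (ℕP.<⇒≱ (subst (ℕ.suc h ℕ.<_) (sym p≡1+2h) (s≤s (ℕP.m<m+n h 1≤h))))
        where
        root : ∀ (η : Fin p) → ∃ λ (z : Fin p) → V (⌊ z ⌋ * ⌊ z ⌋ - ⌊ η ⌋)
        root η = decidable-stable (FinP.any? λ z → V? _) (λ ¬root → all-roots (η , ¬root))
        half : Fin p → Fin (ℕ.suc h)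
        half η = proj₁ (half-square ⌊ proj₁ (root η) ⌋)
        half-spec : ∀ η → V (⌊ η ⌋ - ⌊ half η ⌋ * ⌊ half η ⌋)
        half-spec η = subst V (lemma ⌊ η ⌋ (⌊ proj₁ (root η) ⌋ * ⌊ proj₁ (root η) ⌋) (⌊ half η ⌋ * ⌊ half η ⌋))
          ((- 1ℤ) ⟨*⟩ proj₂ (root η) ⟨+⟩ proj₂ (half-square ⌊ proj₁ (root η) ⌋))
          where
          lemma : ∀ η z i → - 1ℤ * (z - η) + (z - i) ≡ η - i
          lemma = solve-∀
        half-injective : ∀ {η η′} → half η ≡ half η′ → η ≡ η′
        half-injective {η} {η′} eq = V-Fin-injective η η′ (subst V (lemma ⌊ η ⌋ ⌊ η′ ⌋ (⌊ half η ⌋ * ⌊ half η ⌋))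
          (half-spec η ⟨+⟩ (- 1ℤ) ⟨*⟩ subst (λ i → V (⌊ η′ ⌋ - ⌊ i ⌋ * ⌊ i ⌋)) (sym eq) (half-spec η′)))
          where
          lemma : ∀ a b c → (a - c) + - 1ℤ * (b - c) ≡ a - b
          lemma = solve-∀

      module _ (m : ℤ) (anisotropic : ∀ z → ¬ V (z * z + m)) where

        -- If v were invertible, u / v would be a square root of - m.
        norm-≢0 : ∀ u v → V (u * u + m * (v * v)) → V v
        norm-≢0 u v Vn with V? v
        ... | yes Vv = Vv
        ... | no ¬Vv with inverse v ¬Vv
        ...   | v′ , vv′≡1 = contradiction
          (subst V (sym (lemma u v v′ m)) ((v′ * v′) ⟨*⟩ Vn ⟨+⟩ (- (m * (v * v′ + 1ℤ))) ⟨*⟩ vv′≡1))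
          (anisotropic (u * v′))
          where
          lemma : ∀ u v v′ m → (u * v′) * (u * v′) + m
            ≡ (v′ * v′) * (u * u + m * (v * v)) + - (m * (v * v′ + 1ℤ)) * (v * v′ - 1ℤ)
          lemma = solve-∀

        Root : ℤ → Set
        Root a = ∃ λ (z : Fin p) → V (⌊ z ⌋ * ⌊ z ⌋ - a)

        -- The solutions t ≢ 0 of z² = m t (N - t) are parametrised by y = z / t through
        -- t (y² + m) = m N, and y matters only up to sign.
        bad-parameters : ∀ τ δ N → ¬ V δ → ∀ {us : List (Fin p)} → Unique us →
          (∀ {u} → u ∈ us → Root (m * ((τ + ⌊ u ⌋ * δ) * (N - (τ + ⌊ u ⌋ * δ))))) →
          length us ℕ.≤ 2 ℕ.+ h
        bad-parameters τ δ N ¬Vδ {us} unique bad =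
          subst (length us ℕ.≤_) (length-tabulate {n = 2 ℕ.+ h} (λ i → i))
            (length-≤-via Code (λ {u} {u′} {i} → code-injective u u′ i) (allFin (2 ℕ.+ h)) unique
              λ {u} u∈us → let (i , c) = code u (bad u∈us) in i , ∈-allFin i , c)
          where
          t : Fin p → ℤ
          t u = τ + ⌊ u ⌋ * δ
          -- One code is reserved for t = 0; the other 1 + h stand for y up to sign. A code
          -- determines t because y² + m does not vanish, and t determines u because δ does not
          -- vanish.
          Code : Fin p → Fin (2 ℕ.+ h) → Set
          Code u zero = V (t u)
          Code u (suc i) = V (t u * (⌊ i ⌋ * ⌊ i ⌋ + m) - m * N)
          t-injective : ∀ u u′ → V (t u - t u′) → u ≡ u′
          t-injective u u′ v = V-Fin-injective u u′ (V-cancel δ _ ¬Vδ (subst V (lemma τ ⌊ u ⌋ ⌊ u′ ⌋ δ) v))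
            where
            lemma : ∀ τ u u′ δ → (τ + u * δ) - (τ + u′ * δ) ≡ δ * (u - u′)
            lemma = solve-∀
          code-injective : ∀ u u′ i → Code u i → Code u′ i → u ≡ u′
          code-injective u u′ zero c c′ =
            t-injective u u′ (subst V (lemma (t u) (t u′)) (c ⟨+⟩ (- 1ℤ) ⟨*⟩ c′))
            where
            lemma : ∀ a b → a + - 1ℤ * b ≡ a - b
            lemma = solve-∀
          code-injective u u′ (suc i) c c′ =
            t-injective u u′ (V-cancel (⌊ i ⌋ * ⌊ i ⌋ + m) _ (anisotropic ⌊ i ⌋)
              (subst V (lemma (t u) (t u′) (⌊ i ⌋ * ⌊ i ⌋ + m) (m * N)) (c ⟨+⟩ (- 1ℤ) ⟨*⟩ c′)))
            where
            lemma : ∀ a b c n → (a * c - n) + - 1ℤ * (b * c - n) ≡ c * (a - b)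
            lemma = solve-∀
          code : ∀ u → Root (m * (t u * (N - t u))) → ∃ λ i → Code u i
          code u (z , v) with V? (t u)
          ... | yes Vt = zero , Vt
          ... | no ¬Vt with inverse (t u) ¬Vt
          ...   | t′ , tt′≡1 = suc (proj₁ i) , subst V (sym (lemma (t u) t′ ⌊ z ⌋ m N (⌊ proj₁ i ⌋ * ⌊ proj₁ i ⌋)))
                ((t u * (t′ * t′)) ⟨*⟩ v ⟨+⟩ (m * (N - t u) * (t u * t′ + 1ℤ)) ⟨*⟩ tt′≡1
                  ⟨+⟩ (- t u) ⟨*⟩ proj₂ i)
            where
            i = half-square (⌊ z ⌋ * t′)
            lemma : ∀ t t′ z m N i → t * (i + m) - m * N
              ≡ (t * (t′ * t′)) * (z * z - m * (t * (N - t)))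
              + ((m * (N - t) * (t * t′ + 1ℤ)) * (t * t′ - 1ℤ) + - t * ((z * t′) * (z * t′) - i))
            lemma = solve-∀

open ModularArithmetic

-- Choosing few shifts that make every pair good.

module GoodShifts where

  open import Data.Integer using (+_; -_; _+_; _-_; _*_; 0ℤ; 1ℤ)
  open ℤ-Ring using (solve-∀)
  open ℤ³

  module Shifts (p : ℕ) (p-prime : Prime p) (h : ℕ) (p≡1+2h : p ≡ ℕ.suc (h ℕ.+ h)) (4≤h : 4 ℕ.≤ h)
    (m : ℤ) (anisotropic : ∀ z → ¬ Modular.V p p-prime (z * z + m)) where

    open Modular p p-prime
    open Residues p p-prime

    m≢0 : ¬ V m
    m≢0 Vm = anisotropic 0ℤ (subst V (lemma m) Vm)
      where
      lemma : ∀ m → m ≡ 0ℤ * 0ℤ + m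
      lemma = solve-∀

    open Geometry p p-prime m

    -- Moving along an axis changes Q(x;y) only if x and y differ in that coordinate, so each
    -- parameter is tried along both axes.
    shift : Fin 2 → Fin p → ℤ × ℤ
    shift zero u = ⌊ u ⌋ , 0ℤ
    shift (suc zero) u = 0ℤ , ⌊ u ⌋

    -- The failure of `Good`, with z confined to representatives of the residues to make it
    -- decidable.
    Obstructed : ℤ × ℤ → ℤ³ → ℤ³ → Set
    Obstructed w x y = Root h p≡1+2h m anisotropic (m * (Q w x y * Q w y x))

    unobstructed⇒good : ∀ {w x y} → ¬ Obstructed w x y → Good w x y
    unobstructed⇒good {w} {x} {y} ¬obs z v = ¬obs
      (proj₁ (residue z) , subst V (lemma z ⌊ proj₁ (residue z) ⌋ (m * (Q w x y * Q w y x)))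
        (v ⟨+⟩ (- (z + ⌊ proj₁ (residue z) ⌋)) ⟨*⟩ proj₂ (residue z)))
      where
      lemma : ∀ z r a → (z * z - a) + - (z + r) * (z - r) ≡ r * r - a
      lemma = solve-∀

    BadShift : Fin p → ℤ³ × ℤ³ → Set
    BadShift u (x , y) = Obstructed (shift zero u) x y × Obstructed (shift (suc zero) u) x y

    badShift? : ∀ u e → Dec (BadShift u e)
    badShift? u (x , y) = FinP.any? (λ z → V? _) ×-dec FinP.any? (λ z → V? _)

    module G = Greedy p BadShift badShift?

    shift-slope : Fin 2 → ℤ³ → ℤ
    shift-slope zero v = c₂ v
    shift-slope (suc zero) v = m * c₃ v

    Q-shift : ∀ axis x y u → Q (shift axis u) x y ≡ Λ (0ℤ , 0ℤ) x (x ⊖ y) + ⌊ u ⌋ * shift-slope axis (x ⊖ y)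
    Q-shift zero x y u = lemma m ⌊ u ⌋ (c₁ x - c₁ y) (c₂ x) (c₃ x) (c₂ x - c₂ y) (c₃ x - c₃ y)
      where
      lemma : ∀ m u d₁ x₂ x₃ d₂ d₃ → d₁ + ((x₂ + u) * d₂ + m * ((x₃ + 0ℤ) * d₃))
        ≡ (d₁ + ((x₂ + 0ℤ) * d₂ + m * ((x₃ + 0ℤ) * d₃))) + u * d₂
      lemma = solve-∀
    Q-shift (suc zero) x y u = lemma m ⌊ u ⌋ (c₁ x - c₁ y) (c₂ x) (c₃ x) (c₂ x - c₂ y) (c₃ x - c₃ y)
      where
      lemma : ∀ m u d₁ x₂ x₃ d₂ d₃ → d₁ + ((x₂ + 0ℤ) * d₂ + m * ((x₃ + u) * d₃))
        ≡ (d₁ + ((x₂ + 0ℤ) * d₂ + m * ((x₃ + 0ℤ) * d₃))) + u * (m * d₃)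
      lemma = solve-∀

    obstructed-bound : ∀ axis x y → ¬ V (shift-slope axis (x ⊖ y)) → ∀ {us} → Unique us →
      (∀ {u} → u ∈ us → Obstructed (shift axis u) x y) → length us ℕ.≤ 2 ℕ.+ h
    obstructed-bound axis x y ¬V-slope unique obstructed =
      bad-parameters h p≡1+2h m anisotropic (Λ (0ℤ , 0ℤ) x (x ⊖ y)) (shift-slope axis (x ⊖ y)) (norm (x ⊖ y))
        ¬V-slope unique λ {u} u∈us → subst (Root h p≡1+2h m anisotropic) (eq u) (obstructed u∈us)
      where
      eq : ∀ u → m * (Q (shift axis u) x y * Q (shift axis u) y x) ≡ _
      eq u = cong (m *_) (cong₂ _*_ (Q-shift axis x y u)
        (trans (Q-sum (shift axis u) x y) (cong (λ q → norm (x ⊖ y) - q) (Q-shift axis x y u))))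

    -- A bad parameter is obstructed along both axes, so it is enough to count along an axis on
    -- which x and y differ.
    badShifts-bound : ∀ x y → ¬ V³ (x ⊖ y) → length (G.badParameters (x , y) (allFin p)) ℕ.≤ 2 ℕ.+ h
    badShifts-bound x y x≢y = cases (V? (c₂ x - c₂ y)) (V? (c₃ x - c₃ y))
      where
      unique : Unique (G.badParameters (x , y) (allFin p))
      unique = filter⁺ (λ u → badShift? u (x , y)) (allFin⁺ p)
      bad : ∀ {u} → u ∈ G.badParameters (x , y) (allFin p) → BadShift u (x , y)
      bad u∈ = proj₂ (∈-filter⁻ (λ u → badShift? u (x , y)) {xs = allFin p} u∈)
      -- Here N = 0, so a root z satisfies z² + m q² = 0 in F_p, which forces q = 0. Then x and y
      -- would agree in the first coordinate too.
      never : V (c₂ x - c₂ y) → V (c₃ x - c₃ y) → ∀ u → ¬ Obstructed (shift zero u) x y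
      never V₂ V₃ u (z , v) = direction-≢0 (c₂ x + ⌊ u ⌋) (c₃ x + 0ℤ) (x ⊖ y)
        (norm-≢0 h p≡1+2h m anisotropic ⌊ z ⌋ q (subst V (lemma m ⌊ z ⌋ q (norm (x ⊖ y)))
          (subst (λ r → V (⌊ z ⌋ * ⌊ z ⌋ - m * (q * r))) (Q-sum (shift zero u) x y) v
            ⟨+⟩ (m * q) ⟨*⟩ ((c₂ x - c₂ y) ⟨*⟩ V₂ ⟨+⟩ m ⟨*⟩ (c₃ x - c₃ y) ⟨*⟩ V₃))))
        x≢y (V₂ , V₃)
        where
        q = Q (shift zero u) x y
        lemma : ∀ m z q n → (z * z - m * (q * (n - q))) + (m * q) * n ≡ z * z + m * (q * q)
        lemma = solve-∀
      cases : Dec (V (c₂ x - c₂ y)) → Dec (V (c₃ x - c₃ y)) →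
        length (G.badParameters (x , y) (allFin p)) ℕ.≤ 2 ℕ.+ h
      cases (no ¬V₂) _ = obstructed-bound zero x y ¬V₂ unique λ u∈ → proj₁ (bad u∈)
      cases (yes _) (no ¬V₃) = obstructed-bound (suc zero) x y (λ v → ¬V₃ (V-cancel m (c₃ x - c₃ y) m≢0 v)) unique
        λ u∈ → proj₂ (bad u∈)
      -- Here x and y agree in the last two coordinates, Q(x;y) = - Q(y;x) and no shift is bad.
      cases (yes V₂) (yes V₃) = ℕP.≤-trans
        (length-⊆ {ys = []} unique λ {u} u∈ → ⊥-elim (never V₂ V₃ u (proj₁ (bad u∈)))) z≤n

    mostlyGood : ∀ x y → ¬ V³ (x ⊖ y) → G.MostlyGood (x , y)
    mostlyGood x y x≢y = begin
      3 ℕ.* length (G.badParameters (x , y) (allFin p)) ≤⟨ ℕP.*-monoʳ-≤ 3 (badShifts-bound x y x≢y) ⟩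
      3 ℕ.* (2 ℕ.+ h)                                   ≡⟨ lemma₁ h ⟩
      2 ℕ.+ 3 ℕ.* h ℕ.+ 4                               ≤⟨ ℕP.+-monoʳ-≤ (2 ℕ.+ 3 ℕ.* h) 4≤h ⟩
      2 ℕ.+ 3 ℕ.* h ℕ.+ h                               ≡⟨ lemma₂ h ⟩
      2 ℕ.* ℕ.suc (h ℕ.+ h)                             ≡⟨ cong (2 ℕ.*_) p≡1+2h ⟨
      2 ℕ.* p                                           ∎
      where
      open ℕP.≤-Reasoning
      lemma₁ : ∀ h → 3 ℕ.* (2 ℕ.+ h) ≡ 2 ℕ.+ 3 ℕ.* h ℕ.+ 4
      lemma₁ = ℕ-Ring.solve-∀
      lemma₂ : ∀ h → 2 ℕ.+ 3 ℕ.* h ℕ.+ h ≡ 2 ℕ.* ℕ.suc (h ℕ.+ h)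
      lemma₂ = ℕ-Ring.solve-∀

    good-shifts : ∀ k (R : List (ℤ³ × ℤ³)) → (∀ {x y} → (x , y) ∈ R → ¬ V³ (x ⊖ y)) →
      length R ℕ.* 2 ℕ.^ k ℕ.< 3 ℕ.^ k →
      Σ (Fin k → Fin p) λ f → ∀ {x y} → (x , y) ∈ R → ∃ λ i → ∃ λ axis → Good (shift axis (f i)) x y
    good-shifts k R distinct small =
      let (f , covers) = G.greedy-cover k R (λ {(x , y)} e∈R → mostlyGood x y (distinct e∈R)) small
      in f , λ {x} {y} e∈R → let (i , ¬bad) = covers e∈R in i , choose x y (f i) ¬bad
      where
      choose : ∀ x y u → ¬ BadShift u (x , y) → ∃ λ axis → Good (shift axis u) x y
      choose x y u ¬bad with FinP.any? (λ z → V? (⌊ z ⌋ * ⌊ z ⌋ - m * (Q (shift zero u) x y * Q (shift zero u) y x)))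
      ... | no ¬obs = zero , unobstructed⇒good {shift zero u} {x} {y} ¬obs
      ... | yes obs = suc zero , unobstructed⇒good {shift (suc zero) u} {x} {y} λ obs′ → ¬bad (obs , obs′)

open GoodShifts

-- Counting the colours on at most five vertices by repeated splitting.

module LeftoverStructures where

  open import Data.Nat
  open import Data.Nat.Properties hiding (_≟_)

  module Colours {X K : Set} (_≟_ : DecidableEquality K)
    (c : X → X → K) (c-sym : ∀ x y → c x y ≡ c y x) where

    open import Data.List.Membership.DecPropositional _≟_ using (_∈?_)

    Within : List X → K → Set
    Within S κ = ∃₂ λ x y → x ∈ S × y ∈ S × x ≢ y × c x y ≡ κ

    Between : List X → List X → K → Set
    Between A B κ = ∃₂ λ a b → a ∈ A × b ∈ B × c a b ≡ κ

    -- A lower bound for a number of colours, kept as a list of witnesses so that bounds for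
    -- disjoint predicates add up by concatenation.
    Distinct : (K → Set) → ℕ → Set
    Distinct P m = ∃ λ κs → Unique κs × m ≤ length κs × (∀ {κ} → κ ∈ κs → P κ)

    Distinct-map : ∀ {P Q : K → Set} {m} → (∀ {κ} → P κ → Q κ) → Distinct P m → Distinct Q m
    Distinct-map f (κs , unique , long , all) = κs , unique , long , λ κ∈ → f (all κ∈)

    Distinct-++ : ∀ {P Q : K → Set} {m n} → (∀ {κ} → P κ → ¬ Q κ) →
      Distinct P m → Distinct Q n → Distinct (λ κ → P κ ⊎ Q κ) (m + n)
    Distinct-++ {P} {Q} {m} {n} disjoint (κs , unique , long , all) (κs′ , unique′ , long′ , all′) =
      κs ++ κs′ , ++⁺ unique unique′ (λ (κ∈ , κ∈′) → disjoint (all κ∈) (all′ κ∈′)) ,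
      subst (m + n ≤_) (sym (length-++ κs)) (+-mono-≤ long long′) ,
      λ κ∈ → Sum.map all all′ (∈-++⁻ κs κ∈)

    Distinct-∷ : ∀ {P : K → Set} {κ m} → P κ → ((κs , _) : Distinct P m) → ¬ κ ∈ κs → Distinct P (suc m)
    Distinct-∷ {κ = κ} Pκ (κs , unique , long , all) κ∉ =
      κ ∷ κs , All.tabulate (λ { κ′∈ refl → κ∉ κ′∈ }) ∷ unique , s≤s long ,
      λ { (here refl) → Pκ ; (there κ′∈) → all κ′∈ }

    Distinct-1 : ∀ {P : K → Set} {κ} → P κ → Distinct P 1
    Distinct-1 {κ = κ} Pκ = κ ∷ [] , [] ∷ [] , ≤-refl , λ { (here refl) → Pκ }

    -- The interface to the first component of the colouring: the count below draws on that
    -- component only through these fields.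
    record Split (S : List X) : Set where
      field
        A B       : List X
        A-unique  : Unique A
        B-unique  : Unique B
        A⊆S       : ∀ {x} → x ∈ A → x ∈ S
        B⊆S       : ∀ {x} → x ∈ B → x ∈ S
        lengths   : length A + length B ≡ length S
        A-nonempty : 1 ≤ length A
        B-nonempty : 1 ≤ length B
        disjoint  : ∀ {a b} → a ∈ A → b ∈ B → a ≢ b
        crossing  : ∀ {κ} → Between A B κ → ¬ (Within A κ ⊎ Within B κ)
        parallel  : ∀ {κ} → Within A κ → Within B κ → Distinct (Between A B) 3

    swap-between : ∀ {A B κ} → Between A B κ → Between B A κ
    swap-between (a , b , a∈ , b∈ , eq) = b , a , b∈ , a∈ , trans (c-sym b a) eq

    swap : ∀ {S} → Split S → Split S
    swap s = record
      { A = B ; B = A ; A-unique = B-unique ; B-unique = A-unique ; A⊆S = B⊆S ; B⊆S = A⊆S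
      ; lengths = trans (+-comm (length B) (length A)) lengths
      ; A-nonempty = B-nonempty ; B-nonempty = A-nonempty
      ; disjoint = λ b∈ a∈ eq → disjoint a∈ b∈ (sym eq)
      ; crossing = λ β w → crossing (swap-between β) (Sum.swap w)
      ; parallel = λ w w′ → Distinct-map swap-between (parallel w′ w)
      }
      where open Split s

    module _ {S} (s : Split S) where
      open Split s

      add : ∀ {m n} → Distinct (Between A B) m → Distinct (λ κ → Within A κ ⊎ Within B κ) n →
        Distinct (Within S) (m + n)
      add ds ds′ = Distinct-map
        (λ { (inj₁ (a , b , a∈ , b∈ , eq)) → a , b , A⊆S a∈ , B⊆S b∈ , disjoint a∈ b∈ , eq
           ; (inj₂ (inj₁ (x , y , x∈ , y∈ , x≢y , eq))) → x , y , A⊆S x∈ , A⊆S y∈ , x≢y , eq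
           ; (inj₂ (inj₂ (x , y , x∈ , y∈ , x≢y , eq))) → x , y , B⊆S x∈ , B⊆S y∈ , x≢y , eq })
        (Distinct-++ crossing ds ds′)

      Mono : Set
      Mono = ∃ λ κ → ∀ {a b} → a ∈ A → b ∈ B → c a b ≡ κ

      between-colours : Mono ⊎ Distinct (Between A B) 2
      between-colours = go A B refl refl A-nonempty B-nonempty
        where
        go : ∀ A′ B′ → A ≡ A′ → B ≡ B′ → 1 ≤ length A′ → 1 ≤ length B′ → Mono ⊎ Distinct (Between A B) 2
        go (a ∷ _) (b ∷ _) eqA eqB _ _ with All.all? (λ a′ → All.all? (λ b′ → c a′ b′ ≟ c a b) B) A
        ... | yes all = inj₁ (c a b , λ a∈ b∈ → All.lookup (All.lookup all a∈) b∈)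
        ... | no ¬all with find (¬All⇒Any¬ (λ a′ → All.all? (λ b′ → c a′ b′ ≟ c a b) B) A ¬all)
        ...   | a′ , a′∈ , ¬all′ with find (¬All⇒Any¬ (λ b′ → c a′ b′ ≟ c a b) B ¬all′)
        ...     | b′ , b′∈ , c≢ = inj₂ (Distinct-∷ (a′ , b′ , a′∈ , b′∈ , refl)
                  (Distinct-1 (a , b , subst (a ∈_) (sym eqA) (here refl) , subst (b ∈_) (sym eqB) (here refl) , refl))
                  λ { (here eq) → c≢ eq })

      between-colour : Distinct (Between A B) 1
      between-colour = go A B refl refl A-nonempty B-nonempty
        where
        go : ∀ A′ B′ → A ≡ A′ → B ≡ B′ → 1 ≤ length A′ → 1 ≤ length B′ → Distinct (Between A B) 1
        go (a ∷ _) (b ∷ _) eqA eqB _ _ =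
          Distinct-1 (a , b , subst (a ∈_) (sym eqA) (here refl) , subst (b ∈_) (sym eqB) (here refl) , refl)

    module Bound
      (split : ∀ S → Unique S → 2 ≤ length S → Split S)
      (no-caterpillar : ∀ a b x d e → a ≢ b → b ≢ x → x ≢ d → a ≢ x → a ≢ d → a ≢ e → b ≢ d → b ≢ e → x ≢ e → d ≢ e →
        c a b ≡ c a x → c a x ≡ c a d → c a d ≡ c a e → c b x ≡ c b d → c b d ≡ c b e → c x d ≡ c x e → ⊥)
      (no-coned-C₄ : ∀ a b b′ d d′ → a ≢ b → a ≢ b′ → a ≢ d → a ≢ d′ → b ≢ b′ → d ≢ d′ →
        b ≢ d → b ≢ d′ → b′ ≢ d → b′ ≢ d′ →
        c a b ≡ c a b′ → c a b ≡ c a d → c a d ≡ c a d′ → c b d ≡ c b d′ → c b′ d ≡ c b′ d′ → c b d ≡ c b′ d → ⊥)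
      (no-K₂₃ : ∀ a b x d e → a ≢ b → x ≢ d → x ≢ e → d ≢ e →
        a ≢ x → a ≢ d → a ≢ e → b ≢ x → b ≢ d → b ≢ e →
        c a x ≡ c a d → c a d ≡ c a e → c b x ≡ c b d → c b d ≡ c b e → c a x ≡ c b x → c x d ≡ c x e → ⊥)
      where

      small-split : ∀ S → Unique S → 2 ≤ length S → Σ (Split S) λ s → length (Split.A s) ≤ length (Split.B s)
      small-split S unique 2≤S with split S unique 2≤S
      ... | s with ≤-total (length (Split.A s)) (length (Split.B s))
      ...   | inj₁ A≤B = s , A≤B
      ...   | inj₂ B≤A = swap s , B≤A

      too-long : ∀ {n} t (A B : List X) → length A ≤ length B → length A + length B ≡ n →
        t ≤ length A → n < t + t → ⊥
      too-long t A B A≤B eq t≤A n<2t =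
        <-irrefl refl (<-≤-trans n<2t (subst (t + t ≤_) eq (+-mono-≤ t≤A (≤-trans t≤A A≤B))))

      Star : List X → Set
      Star S = ∃₂ λ x d → ∃ λ e → x ∈ S × d ∈ S × e ∈ S × x ≢ d × x ≢ e × d ≢ e × c x d ≡ c x e

      Caterpillar : List X → Set
      Caterpillar S = ∃₂ λ b x → ∃₂ λ d e → b ∈ S × x ∈ S × d ∈ S × e ∈ S ×
        b ≢ x × b ≢ d × b ≢ e × x ≢ d × x ≢ e × d ≢ e × c b x ≡ c b d × c b d ≡ c b e × c x d ≡ c x e

      MonoC₄ : List X → Set
      MonoC₄ S = ∃₂ λ b b′ → ∃₂ λ d d′ → b ∈ S × b′ ∈ S × d ∈ S × d′ ∈ S ×
        b ≢ b′ × d ≢ d′ × b ≢ d × b ≢ d′ × b′ ≢ d × b′ ≢ d′ ×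
        c b d ≡ c b d′ × c b′ d ≡ c b′ d′ × c b d ≡ c b′ d

      pair-colour : ∀ S → Unique S → length S ≡ 2 → Distinct (Within S) 1
      pair-colour (x ∷ y ∷ []) ((x≢y ∷ []) ∷ _) refl =
        Distinct-1 (x , y , here refl , there (here refl) , x≢y , refl)

      -- In a split 1 + 2 the inner edge has a colour of its own, and the two crossing edges either
      -- add two more or form a star in one colour.
      triple-colours : ∀ S → Unique S → length S ≡ 3 →
        Distinct (Within S) 3 ⊎ (Distinct (Within S) 2 × Star S)
      triple-colours S unique len with small-split S unique (subst (2 ≤_) (sym len) (s≤s (s≤s z≤n)))
      ... | s , A≤B = go (Split.A s) (Split.B s) refl refl (trans (Split.lengths s) len)
        where
        open Split s
        go : ∀ A′ B′ → A ≡ A′ → B ≡ B′ → length A′ + length B′ ≡ 3 →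
          Distinct (Within S) 3 ⊎ (Distinct (Within S) 2 × Star S)
        go [] _ refl _ _ = contradiction A-nonempty λ ()
        go A′@(_ ∷ _ ∷ _) B′ refl refl eq = ⊥-elim (too-long 2 A′ B′ A≤B eq (s≤s (s≤s z≤n)) ≤-refl)
        go (a ∷ []) (d ∷ e ∷ []) refl refl _ = result between B-unique
          where
          between = between-colours s
          inner : Distinct (λ κ → Within A κ ⊎ Within B κ) 1
          inner = Distinct-map inj₂ (pair-colour B B-unique refl)
          result : Mono s ⊎ Distinct (Between A B) 2 → Unique B →
            Distinct (Within S) 3 ⊎ (Distinct (Within S) 2 × Star S)
          result (inj₂ two) _ = inj₁ (add s two inner)
          result (inj₁ (κ , mono)) ((d≢e ∷ []) ∷ _) = inj₂ (add s (between-colour s) inner ,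
            a , d , e , A⊆S (here refl) , B⊆S (here refl) , B⊆S (there (here refl)) ,
            disjoint (here refl) (here refl) , disjoint (here refl) (there (here refl)) , d≢e ,
            trans (mono (here refl) (here refl)) (sym (mono (here refl) (there (here refl)))))

      -- A split 1 + 3 falls short only if a single crossing colour meets a star, which is a
      -- caterpillar. In a split 2 + 2 equal inner colours force three crossing colours, and
      -- different ones fall short only if the crossing edges form a monochromatic C₄.
      quadruple-colours : ∀ S → Unique S → length S ≡ 4 →
        Distinct (Within S) 4 ⊎ (Distinct (Within S) 3 × (Caterpillar S ⊎ MonoC₄ S))
      quadruple-colours S unique len with small-split S unique (subst (2 ≤_) (sym len) (s≤s (s≤s z≤n)))
      ... | s , A≤B = go (Split.A s) (Split.B s) refl refl (trans (Split.lengths s) len)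
        where
        open Split s
        Result : Set
        Result = Distinct (Within S) 4 ⊎ (Distinct (Within S) 3 × (Caterpillar S ⊎ MonoC₄ S))
        go : ∀ A′ B′ → A ≡ A′ → B ≡ B′ → length A′ + length B′ ≡ 4 → Result
        go [] _ refl _ _ = contradiction A-nonempty λ ()
        go A′@(_ ∷ _ ∷ _ ∷ _) B′ refl refl eq = ⊥-elim (too-long 3 A′ B′ A≤B eq (s≤s (s≤s (s≤s z≤n))) (n≤1+n 5))
        go (a ∷ []) (_ ∷ _ ∷ _ ∷ []) refl refl _ = result (between-colours s) (triple-colours B B-unique refl)
          where
          a∈ : a ∈ A
          a∈ = here refl
          result : Mono s ⊎ Distinct (Between A B) 2 → Distinct (Within B) 3 ⊎ (Distinct (Within B) 2 × Star B) → Result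
          result _ (inj₁ three) = inj₁ (add s (between-colour s) (Distinct-map inj₂ three))
          result (inj₂ two) (inj₂ (two′ , _)) = inj₁ (add s two (Distinct-map inj₂ two′))
          result (inj₁ (κ , mono)) (inj₂ (two′ , x , d , e , x∈ , d∈ , e∈ , x≢d , x≢e , d≢e , xd≡xe)) =
            inj₂ (add s (between-colour s) (Distinct-map inj₂ two′) , inj₁
              (a , x , d , e , A⊆S a∈ , B⊆S x∈ , B⊆S d∈ , B⊆S e∈ ,
               disjoint a∈ x∈ , disjoint a∈ d∈ , disjoint a∈ e∈ , x≢d , x≢e , d≢e ,
               trans (mono a∈ x∈) (sym (mono a∈ d∈)) , trans (mono a∈ d∈) (sym (mono a∈ e∈)) , xd≡xe))
        go (b ∷ b′ ∷ []) (d ∷ d′ ∷ []) refl refl _ = result A-unique B-unique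
          where
          result : Unique A → Unique B → Result
          result ((b≢b′ ∷ []) ∷ _) ((d≢d′ ∷ []) ∷ _) with c b b′ ≟ c d d′
          ... | yes bb′≡dd′ = inj₁ (add s
              (parallel (b , b′ , here refl , there (here refl) , b≢b′ , refl)
                        (d , d′ , here refl , there (here refl) , d≢d′ , sym bb′≡dd′))
              (Distinct-map inj₂ (pair-colour B B-unique refl)))
          ... | no bb′≢dd′ = cases (between-colours s)
            where
            inner : Distinct (λ κ → Within A κ ⊎ Within B κ) 2
            inner = Distinct-∷ (inj₁ (b , b′ , here refl , there (here refl) , b≢b′ , refl))
              (Distinct-1 (inj₂ (d , d′ , here refl , there (here refl) , d≢d′ , refl)))
              λ { (here eq) → bb′≢dd′ eq }
            cases : Mono s ⊎ Distinct (Between A B) 2 → Result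
            cases (inj₂ two) = inj₁ (add s two inner)
            cases (inj₁ (κ , mono)) = inj₂ (add s (between-colour s) inner , inj₂
              (b , b′ , d , d′ , A⊆S b∈ , A⊆S b′∈ , B⊆S d∈ , B⊆S d′∈ , b≢b′ , d≢d′ ,
               disjoint b∈ d∈ , disjoint b∈ d′∈ , disjoint b′∈ d∈ , disjoint b′∈ d′∈ ,
               trans (mono b∈ d∈) (sym (mono b∈ d′∈)) ,
               trans (mono b′∈ d∈) (sym (mono b′∈ d′∈)) ,
               trans (mono b∈ d∈) (sym (mono b′∈ d∈))))
              where
              b∈ : b ∈ A
              b∈ = here refl
              b′∈ : b′ ∈ A
              b′∈ = there (here refl)
              d∈ : d ∈ B
              d∈ = here refl
              d′∈ : d′ ∈ B
              d′∈ = there (here refl)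

      -- A split 1 + 4 falls short only if a single crossing colour meets a caterpillar or a C₄. In
      -- a split 2 + 3 there are three crossing colours if the colour of aa′ recurs in the list for
      -- B; otherwise only a single crossing colour over a star falls short, the K₂₃ case.
      five-colours : ∀ S → Unique S → length S ≡ 5 → Distinct (Within S) 5
      five-colours S unique len with small-split S unique (subst (2 ≤_) (sym len) (s≤s (s≤s z≤n)))
      ... | s , A≤B = go (Split.A s) (Split.B s) refl refl (trans (Split.lengths s) len)
        where
        open Split s
        go : ∀ A′ B′ → A ≡ A′ → B ≡ B′ → length A′ + length B′ ≡ 5 → Distinct (Within S) 5
        go [] _ refl _ _ = contradiction A-nonempty λ ()
        go A′@(_ ∷ _ ∷ _ ∷ _) B′ refl refl eq = ⊥-elim (too-long 3 A′ B′ A≤B eq (s≤s (s≤s (s≤s z≤n))) ≤-refl)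
        go (a ∷ []) (_ ∷ _ ∷ _ ∷ _ ∷ []) refl refl _ = result (between-colours s) (quadruple-colours B B-unique refl)
          where
          a∈ : a ∈ A
          a∈ = here refl
          result : Mono s ⊎ Distinct (Between A B) 2 →
            Distinct (Within B) 4 ⊎ (Distinct (Within B) 3 × (Caterpillar B ⊎ MonoC₄ B)) → Distinct (Within S) 5
          result _ (inj₁ four) = add s (between-colour s) (Distinct-map inj₂ four)
          result (inj₂ two) (inj₂ (three , _)) = add s two (Distinct-map inj₂ three)
          result (inj₁ (κ , mono)) (inj₂ (_ , inj₁ (b , x , d , e , b∈ , x∈ , d∈ , e∈ ,
              b≢x , b≢d , b≢e , x≢d , x≢e , d≢e , bx≡bd , bd≡be , xd≡xe))) =
            ⊥-elim (no-caterpillar a b x d e (disjoint a∈ b∈) b≢x x≢d (disjoint a∈ x∈) (disjoint a∈ d∈) (disjoint a∈ e∈)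
              b≢d b≢e x≢e d≢e
              (trans (mono a∈ b∈) (sym (mono a∈ x∈))) (trans (mono a∈ x∈) (sym (mono a∈ d∈)))
              (trans (mono a∈ d∈) (sym (mono a∈ e∈))) bx≡bd bd≡be xd≡xe)
          result (inj₁ (κ , mono)) (inj₂ (_ , inj₂ (b , b′ , d , d′ , b∈ , b′∈ , d∈ , d′∈ ,
              b≢b′ , d≢d′ , b≢d , b≢d′ , b′≢d , b′≢d′ , bd≡bd′ , b′d≡b′d′ , bd≡b′d))) =
            ⊥-elim (no-coned-C₄ a b b′ d d′ (disjoint a∈ b∈) (disjoint a∈ b′∈) (disjoint a∈ d∈) (disjoint a∈ d′∈)
              b≢b′ d≢d′ b≢d b≢d′ b′≢d b′≢d′
              (trans (mono a∈ b∈) (sym (mono a∈ b′∈))) (trans (mono a∈ b∈) (sym (mono a∈ d∈)))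
              (trans (mono a∈ d∈) (sym (mono a∈ d′∈))) bd≡bd′ b′d≡b′d′ bd≡b′d)
        go (a ∷ a′ ∷ []) (_ ∷ _ ∷ _ ∷ []) refl refl _ = result A-unique (triple-colours B B-unique refl)
          where
          a∈ : a ∈ A
          a∈ = here refl
          a′∈ : a′ ∈ A
          a′∈ = there (here refl)
          repeated : ∀ {m} → a ≢ a′ → ((κs , _) : Distinct (Within B) m) → c a a′ ∈ κs → Distinct (Within S) (3 + m)
          repeated a≢a′ ds@(κs , _ , _ , all) κ∈ =
            add s (parallel (a , a′ , a∈ , a′∈ , a≢a′ , refl) (all κ∈)) (Distinct-map inj₂ ds)
          fresh : ∀ {m} → a ≢ a′ → ((κs , _) : Distinct (Within B) m) → ¬ c a a′ ∈ κs →
            Distinct (λ κ → Within A κ ⊎ Within B κ) (suc m)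
          fresh a≢a′ ds κ∉ = Distinct-∷ (inj₁ (a , a′ , a∈ , a′∈ , a≢a′ , refl)) (Distinct-map inj₂ ds) κ∉
          result : Unique A → Distinct (Within B) 3 ⊎ (Distinct (Within B) 2 × Star B) → Distinct (Within S) 5
          result ((a≢a′ ∷ []) ∷ _) (inj₁ three) with c a a′ ∈? proj₁ three
          ... | yes κ∈ = weaken (repeated a≢a′ three κ∈)
            where
            weaken : Distinct (Within S) 6 → Distinct (Within S) 5
            weaken (κs , u , long , all) = κs , u , <⇒≤ long , all
          ... | no κ∉ = add s (between-colour s) (fresh a≢a′ three κ∉)
          result ((a≢a′ ∷ []) ∷ _) (inj₂ (two , x , d , e , x∈ , d∈ , e∈ , x≢d , x≢e , d≢e , xd≡xe))
            with c a a′ ∈? proj₁ two | between-colours s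
          ... | yes κ∈ | _ = repeated a≢a′ two κ∈
          ... | no κ∉ | inj₂ two′ = add s two′ (fresh a≢a′ two κ∉)
          ... | no _ | inj₁ (κ , mono) = ⊥-elim (no-K₂₃ a a′ x d e a≢a′ x≢d x≢e d≢e
              (disjoint a∈ x∈) (disjoint a∈ d∈) (disjoint a∈ e∈) (disjoint a′∈ x∈) (disjoint a′∈ d∈) (disjoint a′∈ e∈)
              (trans (mono a∈ x∈) (sym (mono a∈ d∈))) (trans (mono a∈ d∈) (sym (mono a∈ e∈)))
              (trans (mono a′∈ x∈) (sym (mono a′∈ d∈))) (trans (mono a′∈ d∈) (sym (mono a′∈ e∈)))
              (trans (mono a∈ x∈) (sym (mono a′∈ x∈))) xd≡xe)

open LeftoverStructures

-- Digits, signs and the encoding of colours.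

module ExplicitColouring where

  open import Data.Integer using (+_; -_; _+_; _-_; _*_; 0ℤ; 1ℤ)
  open ℤ-Ring using (solve-∀)
  open ℤ³

  least : ∀ {d} {P : Fin d → Set} → Decidable P → ∃ P →
    ∃ λ i → P i × (∀ j → toℕ j ℕ.< toℕ i → ¬ P j)
  least {suc d} P? (i , Pi) with P? zero
  ... | yes P0 = zero , P0 , λ _ ()
  least {suc d} P? (zero , P0) | no ¬P0 = contradiction P0 ¬P0
  least {suc d} P? (suc i , Pi) | no ¬P0 with least (P? ∘ suc) (i , Pi)
  ... | j , Pj , below = suc j , Pj , λ { zero _ → ¬P0 ; (suc l) (s≤s l<j) → below l l<j }

  funToFin-cong : ∀ {m n} {f g : Fin m → Fin n} → f ≗ g → funToFin f ≡ funToFin g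
  funToFin-cong {zero} _ = refl
  funToFin-cong {suc m} eq = cong₂ combine (eq zero) (funToFin-cong (eq ∘ suc))

  digits : ∀ {n} b d → n ℕ.≤ b ℕ.^ d → Fin n → Fin d → Fin b
  digits b d n≤ x = finToFun (inject≤ x n≤)

  digits-injective : ∀ {n} b d (n≤ : n ℕ.≤ b ℕ.^ d) {x y} → digits b d n≤ x ≗ digits b d n≤ y → x ≡ y
  digits-injective b d n≤ {x} {y} eq = FinP.inject≤-injective n≤ n≤ x y
    (trans (sym (FinP.funToFin-finToFin {d} {b} (inject≤ x n≤)))
      (trans (funToFin-cong eq) (FinP.funToFin-finToFin {d} {b} (inject≤ y n≤))))

  compare : ∀ {n} → Fin n → Fin n → Fin 3
  compare i j with FinP.<-cmp i j
  ... | tri≈ _ _ _ = zero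
  ... | tri< _ _ _ = suc zero
  ... | tri> _ _ _ = suc (suc zero)

  compare-refl : ∀ {n} (i : Fin n) → compare i i ≡ zero
  compare-refl i with FinP.<-cmp i i
  ... | tri≈ _ _ _ = refl
  ... | tri< _ i≢i _ = contradiction refl i≢i
  ... | tri> _ i≢i _ = contradiction refl i≢i

  compare-zero : ∀ {n} (i j : Fin n) → compare i j ≡ zero → i ≡ j
  compare-zero i j eq with FinP.<-cmp i j
  compare-zero i j eq | tri≈ _ i≡j _ = i≡j
  compare-zero i j () | tri< _ _ _
  compare-zero i j () | tri> _ _ _

  compare-sym : ∀ {n} (i j : Fin n) → compare i j ≡ compare j i → i ≡ j
  compare-sym i j eq with FinP.<-cmp i j | FinP.<-cmp j i
  compare-sym i j eq | tri≈ _ i≡j _ | _ = i≡j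
  compare-sym i j eq | _ | tri≈ _ j≡i _ = sym j≡i
  compare-sym i j eq | tri< i<j _ _ | tri< j<i _ _ = contradiction j<i (ℕP.<⇒≯ i<j)
  compare-sym i j eq | tri> _ _ j<i | tri> _ _ i<j = contradiction j<i (ℕP.<⇒≯ i<j)
  compare-sym i j () | tri< _ _ _ | tri> _ _ _
  compare-sym i j () | tri> _ _ _ | tri< _ _ _

  length-filter-∁ : ∀ {A : Set} {P : A → Set} (P? : Decidable P) xs →
    length (filter P? xs) ℕ.+ length (filter (¬? ∘ P?) xs) ≡ length xs
  length-filter-∁ P? [] = refl
  length-filter-∁ P? (x ∷ xs) with P? x
  ... | yes _ = cong suc (length-filter-∁ P? xs)
  ... | no _ = trans (ℕP.+-suc _ _) (cong suc (length-filter-∁ P? xs))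

  -- For five vertices `edgeColours c v` computes to the ten colours in lexicographic order of i <
  -- j, and each is found by its position; symmetry gives the rest.
  ∈-edgeColours : ∀ {n k} (c : Fin n → Fin n → Fin k) → (∀ x y → c x y ≡ c y x) →
    (v : Fin 5 → Fin n) → ∀ i j → i ≢ j → c (v i) (v j) ∈ edgeColours c v
  ∈-edgeColours c c-sym v = go
    where
    go : ∀ i j → i ≢ j → c (v i) (v j) ∈ edgeColours c v
    go 0F 0F i≢i = contradiction refl i≢i
    go 0F 1F _ = ∈-lookup {xs = edgeColours c v} 0F
    go 0F 2F _ = ∈-lookup {xs = edgeColours c v} 1F
    go 0F 3F _ = ∈-lookup {xs = edgeColours c v} 2F
    go 0F 4F _ = ∈-lookup {xs = edgeColours c v} 3F
    go 1F 0F _ = subst (_∈ edgeColours c v) (c-sym (v 0F) (v 1F)) (go 0F 1F λ ())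
    go 1F 1F i≢i = contradiction refl i≢i
    go 1F 2F _ = ∈-lookup {xs = edgeColours c v} 4F
    go 1F 3F _ = ∈-lookup {xs = edgeColours c v} 5F
    go 1F 4F _ = ∈-lookup {xs = edgeColours c v} 6F
    go 2F 0F _ = subst (_∈ edgeColours c v) (c-sym (v 0F) (v 2F)) (go 0F 2F λ ())
    go 2F 1F _ = subst (_∈ edgeColours c v) (c-sym (v 1F) (v 2F)) (go 1F 2F λ ())
    go 2F 2F i≢i = contradiction refl i≢i
    go 2F 3F _ = ∈-lookup {xs = edgeColours c v} 7F
    go 2F 4F _ = ∈-lookup {xs = edgeColours c v} 8F
    go 3F 0F _ = subst (_∈ edgeColours c v) (c-sym (v 0F) (v 3F)) (go 0F 3F λ ())
    go 3F 1F _ = subst (_∈ edgeColours c v) (c-sym (v 1F) (v 3F)) (go 1F 3F λ ())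
    go 3F 2F _ = subst (_∈ edgeColours c v) (c-sym (v 2F) (v 3F)) (go 2F 3F λ ())
    go 3F 3F i≢i = contradiction refl i≢i
    go 3F 4F _ = ∈-lookup {xs = edgeColours c v} 9F
    go 4F 0F _ = subst (_∈ edgeColours c v) (c-sym (v 0F) (v 4F)) (go 0F 4F λ ())
    go 4F 1F _ = subst (_∈ edgeColours c v) (c-sym (v 1F) (v 4F)) (go 1F 4F λ ())
    go 4F 2F _ = subst (_∈ edgeColours c v) (c-sym (v 2F) (v 4F)) (go 2F 4F λ ())
    go 4F 3F _ = subst (_∈ edgeColours c v) (c-sym (v 3F) (v 4F)) (go 3F 4F λ ())
    go 4F 4F i≢i = contradiction refl i≢i

  -- `level` is the first differing bit, `lo` and `hi` are the blocks of the two ends around it, and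
  -- `signs` has one base-3 digit for each block position. `axis` and `index` name a shift for which
  -- the edge is good, and `value` is β modulo p.
  record Colour (s k p : ℕ) : Set where
    field
      level : Fin (s ℕ.* s)
      lo hi : Fin (2 ℕ.^ s)
      signs : Fin (3 ℕ.^ s)
      axis  : Fin 2
      index : Fin k
      value : Fin p

  colours : ℕ → ℕ → ℕ → ℕ
  colours s k p = s ℕ.* s ℕ.* (2 ℕ.^ s ℕ.* (2 ℕ.^ s ℕ.* (3 ℕ.^ s ℕ.* (2 ℕ.* (k ℕ.* p)))))

  record Coding (A : Set) (n : ℕ) : Set where
    field
      to      : A → Fin n
      from    : Fin n → A
      from-to : ∀ a → from (to a) ≡ a

  coding-Fin : ∀ n → Coding (Fin n) n
  coding-Fin n = record { to = λ i → i ; from = λ i → i ; from-to = λ _ → refl }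

  infixr 4 _coding-×_
  _coding-×_ : ∀ {A B m n} → Coding A m → Coding B n → Coding (A × B) (m ℕ.* n)
  _coding-×_ {n = n} a b = record
    { to = λ (x , y) → combine (to a x) (to b y)
    ; from = λ i → let (j , l) = remQuot n i in from a j , from b l
    ; from-to = λ (x , y) → trans
        (cong (λ (j , l) → from a j , from b l) (FinP.remQuot-combine (to a x) (to b y)))
        (cong₂ _,_ (from-to a x) (from-to b y))
    }
    where open Coding

  coding-Colour : ∀ {s k p} → Coding (Colour s k p) (colours s k p)
  coding-Colour {s} {k} {p} = record
    { to = λ κ → let open Colour κ in to tuple (level , lo , hi , signs , axis , index , value)
    ; from = toColour ∘ from tuple
    ; from-to = λ κ → cong toColour (from-to tuple _)
    }
    where
    open Coding
    tuple = coding-Fin (s ℕ.* s) coding-× coding-Fin (2 ℕ.^ s) coding-× coding-Fin (2 ℕ.^ s) coding-×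
      coding-Fin (3 ℕ.^ s) coding-× coding-Fin 2 coding-× coding-Fin k coding-× coding-Fin p
    toColour : Fin (s ℕ.* s) × Fin (2 ℕ.^ s) × Fin (2 ℕ.^ s) × Fin (3 ℕ.^ s) × Fin 2 × Fin k × Fin p → Colour s k p
    toColour (l , u , v , w , a , i , x) = record
      { level = l ; lo = u ; hi = v ; signs = w ; axis = a ; index = i ; value = x }

  encode : ∀ {s k p} → Colour s k p → Fin (colours s k p)
  encode = Coding.to coding-Colour

  decode : ∀ {s k p} → Fin (colours s k p) → Colour s k p
  decode = Coding.from coding-Colour

  decode-encode : ∀ {s k p} (κ : Colour s k p) → decode (encode κ) ≡ κ
  decode-encode = Coding.from-to coding-Colour

  -- The colouring and its (5,5) property.

  module Construction
    (n s k p : ℕ) (p-prime : Prime p) (m : ℤ) (m≢0 : ¬ Modular.V p p-prime m)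
    (2≤n : 2 ℕ.≤ n) (n≤bits : n ℕ.≤ 2 ℕ.^ (s ℕ.* s))
    (point : Fin n → ℤ³) (point-injective : ∀ {x y} → x ≢ y → ¬ Modular.V³ p p-prime (point x ⊖ point y))
    (weight : Fin 2 → Fin k → ℤ × ℤ)
    (good-weight : ∀ {x y} → x ≢ y → ∃ λ i → ∃ λ axis →
      Geometry.Good p p-prime m (weight axis i) (point x) (point y))
    where

    open Modular p p-prime
    open Residues p p-prime using (residue)
    open Colour
    open Geometry p p-prime m

    bit : Fin n → Fin (s ℕ.* s) → Fin 2
    bit = digits 2 (s ℕ.* s) n≤bits

    block : Fin n → Fin s → Fin (2 ℕ.^ s)
    block x i = funToFin λ j → bit x (combine i j)

    block-bit : ∀ {x y} q → block x (quotient {s} s q) ≡ block y (quotient {s} s q) → bit x q ≡ bit y q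
    block-bit {x} {y} q eq = subst (λ q′ → bit x q′ ≡ bit y q′) (FinP.combine-remQuot {s} s q)
      (trans (sym (FinP.finToFun-funToFin (λ j → bit x (combine (quotient {s} s q) j)) (remainder {s} s q)))
        (trans (cong (λ f → finToFun f (remainder {s} s q)) eq)
          (FinP.finToFun-funToFin (λ j → bit y (combine (quotient {s} s q) j)) (remainder {s} s q))))

    Col : Set
    Col = Colour s k p

    blockOf : Col → Fin s
    blockOf κ = quotient {s} s (level κ)

    weightOf : Col → ℤ × ℤ
    weightOf κ = weight (axis κ) (index κ)

    -- Oriented from the end with bit 0 at `level` to the end with bit 1, as `lo`, `hi` and `signs`
    -- distinguish the ends.
    record Edge (κ : Col) (u v : Fin n) : Set where
      field
        agree : ∀ j → toℕ j ℕ.< toℕ (level κ) → bit u j ≡ bit v j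
        low   : bit u (level κ) ≡ 0F
        high  : bit v (level κ) ≡ 1F
        lo≡   : block u (blockOf κ) ≡ lo κ
        hi≡   : block v (blockOf κ) ≡ hi κ
        signs≡ : ∀ i → finToFun (signs κ) i ≡ compare (block u i) (block v i)
        polar : V (B (weightOf κ) (point u) (point v) - ⌊ value κ ⌋)
        good  : Good (weightOf κ) (point u) (point v)
    open Edge

    0≢1 : _≢_ {A = Fin 2} 0F 1F
    0≢1 ()

    not-0 : ∀ {b : Fin 2} → b ≢ 0F → b ≡ 1F
    not-0 {0F} ≢0 = contradiction refl ≢0
    not-0 {1F} _ = refl

    differing-bit : ∀ {x y} → x ≢ y → ∃ λ q → bit x q ≢ bit y q
    differing-bit {x} {y} x≢y = FinP.¬∀⟶∃¬ _ _ (λ q → bit x q FinP.≟ bit y q)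
      λ eq → x≢y (digits-injective 2 (s ℕ.* s) n≤bits eq)

    orient : ∀ {u v q} → u ≢ v → (∀ j → toℕ j ℕ.< toℕ q → bit u j ≡ bit v j) →
      bit u q ≡ 0F → bit v q ≡ 1F → ∃ λ κ → Edge κ u v
    orient {u} {v} {q} u≢v agree low high =
      let (i , a , good) = good-weight u≢v
          (r , polar) = residue (B (weight a i) (point u) (point v))
      in record
        { level = q ; lo = block u (quotient {s} s q) ; hi = block v (quotient {s} s q)
        ; signs = funToFin (λ l → compare (block u l) (block v l)) ; axis = a ; index = i ; value = r }
      , record
        { agree = agree ; low = low ; high = high ; lo≡ = refl ; hi≡ = refl
        ; signs≡ = FinP.finToFun-funToFin _ ; polar = polar ; good = good }

    edge-colour : ∀ x y → x ≢ y → ∃ λ κ → Edge κ x y ⊎ Edge κ y x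
    edge-colour x y x≢y with least (λ q → ¬? (bit x q FinP.≟ bit y q)) (differing-bit x≢y)
    ... | q , differ , below = cases (bit x q FinP.≟ 0F)
      where
      agree′ : ∀ j → toℕ j ℕ.< toℕ q → bit x j ≡ bit y j
      agree′ j j<q = decidable-stable (bit x j FinP.≟ bit y j) (below j j<q)
      cases : Dec (bit x q ≡ 0F) → ∃ λ κ → Edge κ x y ⊎ Edge κ y x
      cases (yes x0) =
        let (κ , e) = orient x≢y agree′ x0 (not-0 λ y0 → differ (trans x0 (sym y0))) in κ , inj₁ e
      cases (no x≢0) =
        let (κ , e) = orient (x≢y ∘ sym) (λ j j<q → sym (agree′ j j<q))
              (decidable-stable (bit y q FinP.≟ 0F) λ y≢0 → differ (trans (not-0 x≢0) (sym (not-0 y≢0))))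
              (not-0 x≢0)
        in κ , inj₂ e

    -- A value for the diagonal, borrowed from the edge between the first two vertices.
    default : Fin (colours s k p)
    default = encode (proj₁ (edge-colour (inject≤ 0F 2≤n) (inject≤ 1F 2≤n)
      λ eq → contradiction (FinP.inject≤-injective 2≤n 2≤n 0F 1F eq) λ ()))

    -- The smaller vertex is always passed first, so symmetry does not depend on how `edge-colour`
    -- chooses the shift.
    c : Fin n → Fin n → Fin (colours s k p)
    c x y with FinP.<-cmp x y
    ... | tri< _ x≢y _ = encode (proj₁ (edge-colour x y x≢y))
    ... | tri≈ _ _ _   = default
    ... | tri> _ x≢y _ = encode (proj₁ (edge-colour y x (x≢y ∘ sym)))

    c-sym : ∀ x y → c x y ≡ c y x
    c-sym x y with FinP.<-cmp x y | FinP.<-cmp y x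
    ... | tri< _ _ _   | tri> _ _ _   = refl
    ... | tri≈ _ _ _   | tri≈ _ _ _   = refl
    ... | tri> _ _ _   | tri< _ _ _   = refl
    ... | tri< x<y _ _ | tri< y<x _ _ = contradiction y<x (ℕP.<⇒≯ x<y)
    ... | tri> _ _ y<x | tri> _ _ x<y = contradiction y<x (ℕP.<⇒≯ x<y)
    ... | tri< _ x≢y _ | tri≈ _ y≡x _ = contradiction (sym y≡x) x≢y
    ... | tri> _ x≢y _ | tri≈ _ y≡x _ = contradiction (sym y≡x) x≢y
    ... | tri≈ _ x≡y _ | tri< _ y≢x _ = contradiction (sym x≡y) y≢x
    ... | tri≈ _ x≡y _ | tri> _ y≢x _ = contradiction (sym x≡y) y≢x

    col : Fin n → Fin n → Col
    col x y = decode (c x y)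

    c-edge : ∀ {x y} → x ≢ y → Edge (col x y) x y ⊎ Edge (col x y) y x
    c-edge {x} {y} x≢y with FinP.<-cmp x y
    ... | tri≈ _ x≡y _ = contradiction x≡y x≢y
    ... | tri< _ x≢y _ = subst (λ κ → Edge κ x y ⊎ Edge κ y x) (sym (decode-encode _))
      (proj₂ (edge-colour x y x≢y))
    ... | tri> _ x≢y _ = subst (λ κ → Edge κ x y ⊎ Edge κ y x) (sym (decode-encode _))
      (Sum.swap (proj₂ (edge-colour y x (x≢y ∘ sym))))

    -- The part of `Edge` that survives exchanging the ends, which is what the geometry uses.
    record Polar (κ : Col) (x y : Fin n) : Set where
      field
        value≡ : V (B (weightOf κ) (point x) (point y) - ⌊ value κ ⌋)
        good≡  : Good (weightOf κ) (point x) (point y)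
    open Polar

    B-comm : ∀ w x y → B w x y ≡ B w y x
    B-comm (w₂ , w₃) ⟨ x₁ , x₂ , x₃ ⟩ ⟨ y₁ , y₂ , y₃ ⟩ = lemma m w₂ w₃ x₁ x₂ x₃ y₁ y₂ y₃
      where
      lemma : ∀ m w₂ w₃ x₁ x₂ x₃ y₁ y₂ y₃ →
        x₁ + y₁ + (x₂ * y₂ + m * (x₃ * y₃)) + (w₂ * (x₂ + y₂) + m * (w₃ * (x₃ + y₃)))
        ≡ y₁ + x₁ + (y₂ * x₂ + m * (y₃ * x₃)) + (w₂ * (y₂ + x₂) + m * (w₃ * (y₃ + x₃)))
      lemma = solve-∀

    good-sym : ∀ {w x y} → Good w x y → Good w y x
    good-sym {w} {x} {y} good z v = good z (subst (λ e → V (z * z - m * e)) (ℤP.*-comm (Q w y x) (Q w x y)) v)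

    c-polar : ∀ {x y} → x ≢ y → Polar (col x y) x y
    c-polar {x} {y} x≢y with c-edge x≢y
    ... | inj₁ e = record { value≡ = polar e ; good≡ = good e }
    ... | inj₂ e = record
      { value≡ = subst (λ b → V (b - ⌊ value (col x y) ⌋)) (B-comm (weightOf (col x y)) (point y) (point x)) (polar e)
      ; good≡ = good-sym {weightOf (col x y)} {point y} {point x} (good e) }

    polar-same : ∀ {κ x y z} → Polar κ x y → Polar κ x z → Same (weightOf κ) (point x) (point y) (point z)
    polar-same {κ} {x} {y} {z} π π′ = same (subst V
      (lemma (B (weightOf κ) (point x) (point y)) (B (weightOf κ) (point x) (point z)) ⌊ value κ ⌋)
      (value≡ π ⟨+⟩ (- 1ℤ) ⟨*⟩ value≡ π′))
      where
      lemma : ∀ a b c → (a - c) + - 1ℤ * (b - c) ≡ a - b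
      lemma = solve-∀

    polar-via : ∀ {κ x y} → x ≢ y → c x y ≡ κ → Polar (decode κ) x y
    polar-via x≢y refl = c-polar x≢y

    open Colours FinP._≟_ c c-sym

    caterpillar-free : ∀ a b x d e → a ≢ b → b ≢ x → x ≢ d → a ≢ x → a ≢ d → a ≢ e → b ≢ d → b ≢ e → x ≢ e → d ≢ e →
      c a b ≡ c a x → c a x ≡ c a d → c a d ≡ c a e → c b x ≡ c b d → c b d ≡ c b e → c x d ≡ c x e → ⊥
    caterpillar-free a b x d e a≢b b≢x x≢d a≢x a≢d a≢e b≢d b≢e x≢e d≢e ab≡ax ax≡ad ad≡ae bx≡bd bd≡be xd≡xe =
      no-caterpillar m≢0 {weightOf (col a e)} {weightOf (col b e)} {weightOf (col x e)} (point-injective d≢e)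
        (polar-same ab ax) (polar-same ax ad) (polar-same ad ae)
        (polar-same bx bd) (polar-same bd be) (good≡ bx)
        (polar-same xd xe) (good≡ xd)
      where
      ae = c-polar a≢e
      ad = polar-via a≢d ad≡ae
      ax = polar-via a≢x (trans ax≡ad ad≡ae)
      ab = polar-via a≢b (trans ab≡ax (trans ax≡ad ad≡ae))
      be = c-polar b≢e
      bd = polar-via b≢d bd≡be
      bx = polar-via b≢x (trans bx≡bd bd≡be)
      xe = c-polar x≢e
      xd = polar-via x≢d xd≡xe

    coned-C₄-free : ∀ a b b′ d d′ → a ≢ b → a ≢ b′ → a ≢ d → a ≢ d′ → b ≢ b′ → d ≢ d′ →
      b ≢ d → b ≢ d′ → b′ ≢ d → b′ ≢ d′ →
      c a b ≡ c a b′ → c a b ≡ c a d → c a d ≡ c a d′ → c b d ≡ c b d′ → c b′ d ≡ c b′ d′ → c b d ≡ c b′ d → ⊥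
    coned-C₄-free a b b′ d d′ a≢b a≢b′ a≢d a≢d′ b≢b′ d≢d′ b≢d b≢d′ b′≢d b′≢d′ ab≡ab′ ab≡ad ad≡ad′ bd≡bd′ b′d≡b′d′ bd≡b′d =
      no-coned-C₄ m≢0 {weightOf (col a b)} {weightOf (col b d)} (point-injective b≢b′) (point-injective d≢d′)
        (polar-same ab ab′) (polar-same ab ad) (polar-same ad ad′)
        (polar-same bd bd′) (polar-same b′d b′d′) (polar-same db db′) (good≡ bd)
      where
      ab = c-polar a≢b
      ab′ = polar-via a≢b′ (sym ab≡ab′)
      ad = polar-via a≢d (sym ab≡ad)
      ad′ = polar-via a≢d′ (sym (trans ab≡ad ad≡ad′))
      bd = c-polar b≢d
      bd′ = polar-via b≢d′ (sym bd≡bd′)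
      b′d = polar-via b′≢d (sym bd≡b′d)
      b′d′ = polar-via b′≢d′ (sym (trans bd≡b′d b′d≡b′d′))
      db = polar-via (b≢d ∘ sym) (c-sym d b)
      db′ = polar-via (b′≢d ∘ sym) (trans (c-sym d b′) (sym bd≡b′d))

    K₂₃-free : ∀ a b x d e → a ≢ b → x ≢ d → x ≢ e → d ≢ e →
      a ≢ x → a ≢ d → a ≢ e → b ≢ x → b ≢ d → b ≢ e →
      c a x ≡ c a d → c a d ≡ c a e → c b x ≡ c b d → c b d ≡ c b e → c a x ≡ c b x → c x d ≡ c x e → ⊥
    K₂₃-free a b x d e a≢b x≢d x≢e d≢e a≢x a≢d a≢e b≢x b≢d b≢e ax≡ad ad≡ae bx≡bd bd≡be ax≡bx xd≡xe =
      no-K₂₃ m≢0 {weightOf (col a x)} {weightOf (col x e)} (point-injective a≢b) (point-injective d≢e)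
        (polar-same ax ad) (polar-same ad ae) (polar-same bx bd) (polar-same bd be) (polar-same xa xb)
        (polar-same xd xe) (good≡ xd)
      where
      ax = c-polar a≢x
      ad = polar-via a≢d (sym ax≡ad)
      ae = polar-via a≢e (sym (trans ax≡ad ad≡ae))
      bx = polar-via b≢x (sym ax≡bx)
      bd = polar-via b≢d (sym (trans ax≡bx bx≡bd))
      be = polar-via b≢e (sym (trans ax≡bx (trans bx≡bd bd≡be)))
      xa = polar-via (a≢x ∘ sym) (c-sym x a)
      xb = polar-via (b≢x ∘ sym) (trans (c-sym x b) (sym ax≡bx))
      xe = c-polar x≢e
      xd = polar-via x≢d xd≡xe

    edge-via : ∀ {κ x y} → x ≢ y → c x y ≡ κ → Edge (decode κ) x y ⊎ Edge (decode κ) y x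
    edge-via x≢y refl = c-edge x≢y

    lo≢hi : ∀ {κ u v} → Edge κ u v → lo κ ≢ hi κ
    lo≢hi {κ} e eq = 0≢1 (trans (sym (low e)) (trans
      (block-bit (level κ) (trans (lo≡ e) (trans eq (sym (hi≡ e))))) (high e)))

    module _ (S : List (Fin n)) (q : Fin (s ℕ.* s))
      (S-agree : ∀ {x y} → x ∈ S → y ∈ S → ∀ j → toℕ j ℕ.< toℕ q → bit x j ≡ bit y j) where

      level≡ : ∀ {κ u v} → u ∈ S → v ∈ S → Edge κ u v → bit u q ≢ bit v q → level κ ≡ q
      level≡ {κ} {u} {v} u∈ v∈ e differ with FinP.<-cmp (level κ) q
      ... | tri≈ _ eq _ = eq
      ... | tri< l<q _ _ = contradiction (trans (sym (low e)) (trans (S-agree u∈ v∈ (level κ) l<q) (high e))) 0≢1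
      ... | tri> _ _ q<l = contradiction (agree e q q<l) differ

      zero? : ∀ x → Dec (bit x q ≡ 0F)
      zero? x = bit x q FinP.≟ 0F

      S₀ S₁ : List (Fin n)
      S₀ = filter zero? S
      S₁ = filter (¬? ∘ zero?) S

      ∈S₀ : ∀ {x} → x ∈ S₀ → x ∈ S × bit x q ≡ 0F
      ∈S₀ = ∈-filter⁻ zero?

      ∈S₁ : ∀ {x} → x ∈ S₁ → x ∈ S × bit x q ≡ 1F
      ∈S₁ x∈ = let (x∈S , ≢0) = ∈-filter⁻ (¬? ∘ zero?) x∈ in x∈S , not-0 ≢0

      S₀≢S₁ : ∀ {a b} → a ∈ S₀ → b ∈ S₁ → bit a q ≢ bit b q
      S₀≢S₁ a∈ b∈ eq = 0≢1 (trans (sym (proj₂ (∈S₀ a∈))) (trans eq (proj₂ (∈S₁ b∈))))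

      disjoint₀₁ : ∀ {a b} → a ∈ S₀ → b ∈ S₁ → a ≢ b
      disjoint₀₁ a∈ b∈ refl = S₀≢S₁ a∈ b∈ refl

      -- The level of such an edge is q, so its orientation is known, and with it the order in which
      -- `signs` compares the blocks.
      cross-edge : ∀ {a b} → a ∈ S₀ → b ∈ S₁ → Edge (col a b) a b
      cross-edge {a} {b} a∈ b∈ with c-edge (disjoint₀₁ a∈ b∈)
      ... | inj₁ e = e
      ... | inj₂ e = contradiction
        (trans (sym (low e)) (trans (cong (bit b) (level≡ (proj₁ (∈S₁ b∈)) (proj₁ (∈S₀ a∈)) e (S₀≢S₁ a∈ b∈ ∘ sym)))
          (proj₂ (∈S₁ b∈)))) 0≢1

      no-inner-edge : ∀ {κ u v} → level κ ≡ q → bit u q ≡ bit v q → ¬ Edge κ u v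
      no-inner-edge {κ} {u} {v} refl eq e = 0≢1 (trans (sym (low e)) (trans eq (high e)))

      -- A colour records its level. Crossing edges have level q, whereas the ends of an edge inside
      -- one part agree at q.
      crossing₀₁ : ∀ {κ} → Between S₀ S₁ κ → ¬ (Within S₀ κ ⊎ Within S₁ κ)
      crossing₀₁ {κ} (a , b , a∈ , b∈ , refl) = λ
        { (inj₁ (x , y , x∈ , y∈ , x≢y , eq)) → inner x≢y eq (trans (proj₂ (∈S₀ x∈)) (sym (proj₂ (∈S₀ y∈))))
        ; (inj₂ (x , y , x∈ , y∈ , x≢y , eq)) → inner x≢y eq (trans (proj₂ (∈S₁ x∈)) (sym (proj₂ (∈S₁ y∈)))) }
        where
        level≡q : level (col a b) ≡ q
        level≡q = level≡ (proj₁ (∈S₀ a∈)) (proj₁ (∈S₁ b∈)) (cross-edge a∈ b∈) (S₀≢S₁ a∈ b∈)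
        inner : ∀ {x y} → x ≢ y → c x y ≡ κ → bit x q ≢ bit y q
        inner x≢y eq bits with edge-via x≢y eq
        ... | inj₁ e = no-inner-edge level≡q bits e
        ... | inj₂ e = no-inner-edge level≡q (sym bits) e

      -- Edges aa′ and bb′ of one colour have equal end blocks lo and hi at some position i, where
      -- the signs of ab, ab′ and a′b are then =, < and > or =, > and <.
      parallel-edges : ∀ {κ a a′ b b′} → Edge κ a a′ → Edge κ b b′ →
        a ∈ S₀ → a′ ∈ S₀ → b ∈ S₁ → b′ ∈ S₁ → Distinct (Between S₀ S₁) 3
      parallel-edges {κ} {a} {a′} {b} {b′} e e′ a∈ a′∈ b∈ b′∈ =
        Distinct-∷ (a , b , a∈ , b∈ , refl) (Distinct-∷ (a , b′ , a∈ , b′∈ , refl)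
          (Distinct-1 (a′ , b , a′∈ , b∈ , refl))
          λ { (here eq) → lo≢hi e (compare-sym (lo κ) (hi κ)
                (trans (sym (sign a∈ b′∈ (lo≡ e) (hi≡ e′))) (trans (cong signAt eq) (sign a′∈ b∈ (hi≡ e) (lo≡ e′))))) })
        λ { (here eq) → lo≢hi e (compare-zero (lo κ) (hi κ)
              (trans (sym (sign a∈ b′∈ (lo≡ e) (hi≡ e′))) (trans (cong signAt (sym eq))
                (trans (sign a∈ b∈ (lo≡ e) (lo≡ e′)) (compare-refl (lo κ))))))
          ; (there (here eq)) → lo≢hi e (sym (compare-zero (hi κ) (lo κ)
              (trans (sym (sign a′∈ b∈ (hi≡ e) (lo≡ e′))) (trans (cong signAt (sym eq))
                (trans (sign a∈ b∈ (lo≡ e) (lo≡ e′)) (compare-refl (lo κ))))))) }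
        where
        signAt : Fin (colours s k p) → Fin 3
        signAt κ′ = finToFun (signs (decode {s} {k} {p} κ′)) (blockOf κ)
        sign : ∀ {x y u v} → x ∈ S₀ → y ∈ S₁ → block x (blockOf κ) ≡ u → block y (blockOf κ) ≡ v →
          signAt (c x y) ≡ compare u v
        sign x∈ y∈ refl refl = signs≡ (cross-edge x∈ y∈) (blockOf κ)

      parallel₀₁ : ∀ {κ} → Within S₀ κ → Within S₁ κ → Distinct (Between S₀ S₁) 3
      parallel₀₁ (a , a′ , a∈ , a′∈ , a≢a′ , eq) (b , b′ , b∈ , b′∈ , b≢b′ , eq′)
        with edge-via a≢a′ eq | edge-via b≢b′ eq′
      ... | inj₁ e | inj₁ e′ = parallel-edges e e′ a∈ a′∈ b∈ b′∈
      ... | inj₁ e | inj₂ e′ = parallel-edges e e′ a∈ a′∈ b′∈ b∈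
      ... | inj₂ e | inj₁ e′ = parallel-edges e e′ a′∈ a∈ b∈ b′∈
      ... | inj₂ e | inj₂ e′ = parallel-edges e e′ a′∈ a∈ b′∈ b∈

      split-at : Unique S → (∃ λ x → x ∈ S × bit x q ≡ 0F) → (∃ λ y → y ∈ S × bit y q ≡ 1F) → Split S
      split-at unique (x , x∈ , x0) (y , y∈ , y1) = record
        { A = S₀ ; B = S₁
        ; A-unique = filter⁺ zero? unique ; B-unique = filter⁺ (¬? ∘ zero?) unique
        ; A⊆S = proj₁ ∘ ∈S₀ ; B⊆S = proj₁ ∘ ∈S₁
        ; lengths = length-filter-∁ zero? S
        ; A-nonempty = ∈-length (∈-filter⁺ zero? x∈ x0)
        ; B-nonempty = ∈-length (∈-filter⁺ (¬? ∘ zero?) y∈ λ y0 → 0≢1 (trans (sym y0) y1))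
        ; disjoint = disjoint₀₁ ; crossing = crossing₀₁ ; parallel = parallel₀₁ }

    split : ∀ S → Unique S → 2 ℕ.≤ length S → Split S
    split (_ ∷ []) _ (s≤s ())
    split S@(x ∷ y ∷ _) unique@((x≢y ∷ _) ∷ _) _
      -- The first bit at which some member differs from x is the first on which S is not constant:
      -- before it, all members agree with x.
      with least (λ q → Any.any? (λ z → ¬? (bit x q FinP.≟ bit z q)) S)
                 (let (q , differ) = differing-bit x≢y in q , there (here differ))
    ... | q , any , below with find any
    ...   | z , z∈ , differ = cases (bit x q FinP.≟ 0F)
      where
      agree-x : ∀ {w} → w ∈ S → ∀ j → toℕ j ℕ.< toℕ q → bit x j ≡ bit w j
      agree-x {w} w∈ j j<q = decidable-stable (bit x j FinP.≟ bit w j) λ ne → below j j<q (lose w∈ ne)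
      S-agree : ∀ {u v} → u ∈ S → v ∈ S → ∀ j → toℕ j ℕ.< toℕ q → bit u j ≡ bit v j
      S-agree u∈ v∈ j j<q = trans (sym (agree-x u∈ j j<q)) (agree-x v∈ j j<q)
      cases : Dec (bit x q ≡ 0F) → Split S
      cases (yes x0) = split-at S q S-agree unique (x , here refl , x0)
        (z , z∈ , not-0 λ z0 → differ (trans x0 (sym z0)))
      cases (no x≢0) = split-at S q S-agree unique
        (z , z∈ , decidable-stable (bit z q FinP.≟ 0F) λ z≢0 → differ (trans (not-0 x≢0) (sym (not-0 z≢0))))
        (x , here refl , not-0 x≢0)

    open Bound split caterpillar-free coned-C₄-free K₂₃-free using (five-colours)

    colouring : Colouring n (colours s k p)
    colouring = c , c-sym

    is-5-5 : IsPQColouring 5 5 colouring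
    is-5-5 v v-injective =
      let (κs , unique , 5≤ , within) = five-colours (tabulate v) (tabulate⁺ v-injective) refl
      in ℕP.≤-trans 5≤ (length-⊆ unique λ κ∈ → ∈-deduplicate⁺ FinP._≟_ (seen (within κ∈)))
      where
      seen : ∀ {κ} → Within (tabulate v) κ → κ ∈ edgeColours c v
      seen (x , y , x∈ , y∈ , x≢y , refl) with ∈-tabulate⁻ {f = v} x∈ | ∈-tabulate⁻ {f = v} y∈
      ... | i , refl | j , refl = ∈-edgeColours c c-sym v i j λ { refl → x≢y refl }

open ExplicitColouring

-- Estimates for logarithms, for the prime and for the number of colours.

open import Data.Nat
open import Data.Nat.Properties
open import Data.Nat.DivMod using (m≡m%n+[m/n]*n; m%n<n; m/n*n≤m)
open ℕ-Ring using (solve-∀)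

length-cartesianProduct : ∀ {A B : Set} (xs : List A) (ys : List B) →
  length (cartesianProduct xs ys) ≡ length xs * length ys
length-cartesianProduct [] ys = refl
length-cartesianProduct (x ∷ xs) ys = trans (length-++ (map (x ,_) ys))
  (cong₂ _+_ (length-map (x ,_) ys) (length-cartesianProduct xs ys))

n≤2^⌈log₂n⌉ : ∀ n → n ≤ 2 ^ ⌈log₂ n ⌉
n≤2^⌈log₂n⌉ = <-rec _ go
  where
  open ≤-Reasoning
  go : ∀ n → (∀ {m} → m < n → m ≤ 2 ^ ⌈log₂ m ⌉) → n ≤ 2 ^ ⌈log₂ n ⌉
  go 0 _ = z≤n
  go 1 _ = ≤-refl
  go n@(suc (suc n′)) rec = begin
    n                                        ≡⟨ ⌊n/2⌋+⌈n/2⌉≡n n ⟨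
    ⌊ n /2⌋ + ⌈ n /2⌉                        ≤⟨ +-monoˡ-≤ ⌈ n /2⌉ (⌊n/2⌋≤⌈n/2⌉ n) ⟩
    ⌈ n /2⌉ + ⌈ n /2⌉                        ≤⟨ +-mono-≤ half half ⟩
    2 ^ (⌈log₂ n ⌉ ∸ 1) + 2 ^ (⌈log₂ n ⌉ ∸ 1) ≡⟨ cong (2 ^ (⌈log₂ n ⌉ ∸ 1) +_) (+-identityʳ _) ⟨
    2 ^ suc (⌈log₂ n ⌉ ∸ 1)                  ≡⟨ cong (2 ^_) (m+[n∸m]≡n {1} (⌈log₂⌉-mono-≤ {2} {n} (s≤s (s≤s z≤n)))) ⟩
    2 ^ ⌈log₂ n ⌉                            ∎
    where
    half : ⌈ n /2⌉ ≤ 2 ^ (⌈log₂ n ⌉ ∸ 1)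
    half = subst (λ l → ⌈ n /2⌉ ≤ 2 ^ l) (⌈log₂⌈n/2⌉⌉≡⌈log₂n⌉∸1 n) (rec (⌈n/2⌉<n n′))

-- Otherwise taking logarithms of 2n < 2^ℓ would give 1 + ℓ ≤ ℓ.
2^⌈log₂n⌉≤2n : ∀ n → 1 ≤ n → 2 ^ ⌈log₂ n ⌉ ≤ 2 * n
2^⌈log₂n⌉≤2n n 1≤n = ≮⇒≥ λ 2n<2^ℓ → <-irrefl refl
  (subst₂ _≤_ (⌈log₂2*n⌉≡1+⌈log₂n⌉ n {{>-nonZero 1≤n}}) (⌈log₂2^n⌉≡n ⌈log₂ n ⌉) (⌈log₂⌉-mono-≤ (<⇒≤ 2n<2^ℓ)))

n≤n² : ∀ n → n ≤ n * n
n≤n² zero = z≤n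
n≤n² (suc n) = m≤m*n (suc n) (suc n)

-- The rounded root r counts the s with s² < m. If r² < m, all of 0, ..., r would be counted, which
-- is one too many.
⌈√⌉-upper : ∀ m → m ≤ ⌈√ m ⌉ * ⌈√ m ⌉
⌈√⌉-upper m = ≮⇒≥ λ r²<m → <-irrefl refl (begin-strict
  r                                     <⟨ ≤-refl ⟩
  suc r                                 ≡⟨ length-upTo (suc r) ⟨
  length (upTo (suc r))                 ≤⟨ length-⊆ (upTo⁺ (suc r)) (λ s∈ → below r²<m (s≤s⁻¹ (∈-upTo⁻ s∈))) ⟩
  r                                     ∎)
  where
  open ≤-Reasoning
  r = ⌈√ m ⌉
  below : r * r < m → ∀ {s} → s ≤ r → s ∈ filter (λ s → s * s <? m) (upTo m)
  below r²<m {s} s≤r = ∈-filter⁺ (λ s → s * s <? m) (∈-upTo⁺ (≤-<-trans (n≤n² s) s²<m)) s²<m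
    where
    s²<m : s * s < m
    s²<m = ≤-<-trans (*-mono-≤ s≤r s≤r) r²<m

quadratic<exponential : ∀ s → s * s + (s + 5) < 2 ^ (s + 3)
quadratic<exponential zero = s≤s (s≤s (s≤s (s≤s (s≤s (s≤s z≤n)))))
quadratic<exponential (suc s) = begin-strict
  suc s * suc s + (suc s + 5)      ≡⟨ lemma₁ s ⟩
  s * s + 2 * s + 7 + s            ≤⟨ +-monoʳ-≤ (s * s + 2 * s + 7) (n≤n² s) ⟩
  s * s + 2 * s + 7 + s * s        ≤⟨ m≤m+n _ 3 ⟩
  s * s + 2 * s + 7 + s * s + 3    ≡⟨ lemma₂ s ⟩
  2 * (s * s + (s + 5))            <⟨ *-monoʳ-< 2 (quadratic<exponential s) ⟩
  2 * 2 ^ (s + 3)                  ∎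
  where
  open ≤-Reasoning
  lemma₁ : ∀ s → suc s * suc s + (suc s + 5) ≡ s * s + 2 * s + 7 + s
  lemma₁ = solve-∀
  lemma₂ : ∀ s → s * s + 2 * s + 7 + s * s + 3 ≡ 2 * (s * s + (s + 5))
  lemma₂ = solve-∀

n≤2^n : ∀ n → n ≤ 2 ^ n
n≤2^n zero = z≤n
n≤2^n (suc n) = begin
  suc n            ≡⟨ +-comm 1 n ⟩
  n + 1            ≤⟨ +-mono-≤ (n≤2^n n) (m^n>0 2 n) ⟩
  2 ^ n + 2 ^ n    ≡⟨ cong (2 ^ n +_) (+-identityʳ (2 ^ n)) ⟨
  2 ^ suc n        ∎
  where open ≤-Reasoning

-- Here `prime-between` is used with m = 2^e and h = 2^(e + s + 3); its condition reduces to e + s +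
-- 5 < 2^(s + 3). The ratio 2^(s + 5) of the two ends is large but disappears in the factor 2^O(√log
-- n).
prime-in-range : ∀ e s → e ≤ s * s → ∃ λ p → Prime p × 2 ^ e < p × p ≤ 2 ^ (e + s + 5)
prime-in-range e s e≤s² = let (p , p-prime , lower , upper) = prime-between (2 ^ e) (2 ^ g) small in
  p , p-prime , lower , ≤-trans upper bound
  where
  open ≤-Reasoning
  g = e + (s + 3)
  bound : suc (2 ^ g + 2 ^ g) ≤ 2 ^ (e + s + 5)
  bound = begin
    1 + (2 ^ g + 2 ^ g)                 ≤⟨ +-monoˡ-≤ (2 ^ g + 2 ^ g) (≤-trans (m^n>0 2 g) (m≤m+n _ (2 ^ g))) ⟩
    2 ^ g + 2 ^ g + (2 ^ g + 2 ^ g)     ≡⟨ lemma (2 ^ g) ⟩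
    2 * (2 * 2 ^ g)                     ≡⟨ cong (2 ^_) (lemma′ e s) ⟩
    2 ^ (e + s + 5)                     ∎
    where
    lemma : ∀ a → a + a + (a + a) ≡ 2 * (2 * a)
    lemma = solve-∀
    lemma′ : ∀ e s → suc (suc (e + (s + 3))) ≡ e + s + 5
    lemma′ = solve-∀
  small : suc (2 ^ g + 2 ^ g) ^ (2 ^ e) < 2 ^ (2 ^ g)
  small = begin-strict
    suc (2 ^ g + 2 ^ g) ^ (2 ^ e)       ≤⟨ ^-monoˡ-≤ (2 ^ e) bound ⟩
    (2 ^ (e + s + 5)) ^ (2 ^ e)         ≡⟨ ^-*-assoc 2 (e + s + 5) (2 ^ e) ⟩
    2 ^ ((e + s + 5) * 2 ^ e)           <⟨ ^-monoʳ-< 2 ≤-refl exponent ⟩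
    2 ^ (2 ^ g)                         ∎
    where
    exponent : (e + s + 5) * 2 ^ e < 2 ^ g
    exponent = begin-strict
      (e + s + 5) * 2 ^ e               ≡⟨ cong (_* 2 ^ e) (+-assoc e s 5) ⟩
      (e + (s + 5)) * 2 ^ e             ≤⟨ *-monoˡ-≤ (2 ^ e) (+-monoˡ-≤ (s + 5) e≤s²) ⟩
      (s * s + (s + 5)) * 2 ^ e         <⟨ *-monoˡ-< (2 ^ e) {{m^n≢0 2 e}} (quadratic<exponential s) ⟩
      2 ^ (s + 3) * 2 ^ e               ≡⟨ *-comm (2 ^ (s + 3)) (2 ^ e) ⟩
      2 ^ e * 2 ^ (s + 3)               ≡⟨ ^-distribˡ-+-* 2 e (s + 3) ⟨
      2 ^ g                             ∎

-- Since (3/2)⁴ = 81/16 exceeds 4, already 4ℓ rounds outweigh n² ≤ 4^ℓ; one more makes the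
-- inequality strict.
greedy-steps : ∀ n ℓ → n ≤ 2 ^ ℓ → n * n * 2 ^ (4 * ℓ + 1) < 3 ^ (4 * ℓ + 1)
greedy-steps n ℓ n≤2^ℓ = begin-strict
  n * n * 2 ^ (4 * ℓ + 1)               ≤⟨ *-monoˡ-≤ (2 ^ (4 * ℓ + 1)) (*-mono-≤ n≤2^ℓ n≤2^ℓ) ⟩
  2 ^ ℓ * 2 ^ ℓ * 2 ^ (4 * ℓ + 1)       ≡⟨ cong (_* 2 ^ (4 * ℓ + 1)) (^-distribˡ-+-* 2 ℓ ℓ) ⟨
  2 ^ (ℓ + ℓ) * 2 ^ (4 * ℓ + 1)         ≡⟨ ^-distribˡ-+-* 2 (ℓ + ℓ) (4 * ℓ + 1) ⟨
  2 ^ (ℓ + ℓ + (4 * ℓ + 1))             ≡⟨ cong (2 ^_) (lemma ℓ) ⟩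
  2 ^ (6 * ℓ + 1)                       ≡⟨ ^-distribˡ-+-* 2 (6 * ℓ) 1 ⟩
  2 ^ (6 * ℓ) * 2                       ≡⟨ cong (_* 2) (^-*-assoc 2 6 ℓ) ⟨
  64 ^ ℓ * 2                            ≤⟨ *-monoˡ-≤ 2 (^-monoˡ-≤ ℓ (m≤m+n 64 17)) ⟩
  81 ^ ℓ * 2                            <⟨ *-monoʳ-< (81 ^ ℓ) {{m^n≢0 81 ℓ}} ≤-refl ⟩
  81 ^ ℓ * 3                            ≡⟨ cong (_* 3) (^-*-assoc 3 4 ℓ) ⟩
  3 ^ (4 * ℓ) * 3                       ≡⟨ ^-distribˡ-+-* 3 (4 * ℓ) 1 ⟨
  3 ^ (4 * ℓ + 1)                       ∎
  where
  open ≤-Reasoning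
  lemma : ∀ ℓ → ℓ + ℓ + (4 * ℓ + 1) ≡ 6 * ℓ + 1
  lemma = solve-∀

-- With x = 2^s the factors other than p are at most x², x, x, x², x and x⁵, in this order.
colours-bound : ∀ s ℓ p → 1 ≤ s → ℓ ≤ s * s → colours s (4 * ℓ + 1) p ≤ 2 ^ (12 * s) * p
colours-bound s ℓ p 1≤s ℓ≤s² = begin
  s * s * (2 ^ s * (2 ^ s * (3 ^ s * (2 * ((4 * ℓ + 1) * p)))))
    ≤⟨ *-mono-≤ s²≤ (*-monoʳ-≤ x (*-monoʳ-≤ x (*-mono-≤ 3^s≤ (*-mono-≤ 2≤x (*-monoˡ-≤ p k≤))))) ⟩
  x * x * (x * (x * (x * x * (x * (x * x * x * (x * x) * p)))))
    ≡⟨ lemma x p ⟩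
  x ^ 12 * p
    ≡⟨ cong (_* p) (trans (^-*-assoc 2 s 12) (cong (2 ^_) (*-comm s 12))) ⟩
  2 ^ (12 * s) * p                      ∎
  where
  open ≤-Reasoning
  x = 2 ^ s
  2≤x : 2 ≤ x
  2≤x = ^-monoʳ-≤ 2 1≤s
  s²≤ : s * s ≤ x * x
  s²≤ = *-mono-≤ (n≤2^n s) (n≤2^n s)
  3^s≤ : 3 ^ s ≤ x * x
  3^s≤ = begin
    3 ^ s           ≤⟨ ^-monoˡ-≤ s (n≤1+n 3) ⟩
    4 ^ s           ≡⟨ ^-*-assoc 2 2 s ⟩
    2 ^ (2 * s)     ≡⟨ cong (2 ^_) (cong (s +_) (+-identityʳ s)) ⟩
    2 ^ (s + s)     ≡⟨ ^-distribˡ-+-* 2 s s ⟩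
    x * x           ∎
  k≤ : 4 * ℓ + 1 ≤ x * x * x * (x * x)
  k≤ = begin
    4 * ℓ + 1                   ≤⟨ +-mono-≤ (*-monoʳ-≤ 4 ℓ≤s²) (*-mono-≤ 1≤s 1≤s) ⟩
    4 * (s * s) + s * s         ≤⟨ m≤m+n _ (3 * (s * s)) ⟩
    4 * (s * s) + s * s + 3 * (s * s) ≡⟨ lemma₈ (s * s) ⟩
    8 * (s * s)                 ≤⟨ *-mono-≤ (*-mono-≤ (*-mono-≤ 2≤x 2≤x) 2≤x) s²≤ ⟩
    x * x * x * (x * x)         ∎
    where
    lemma₈ : ∀ t → 4 * t + t + 3 * t ≡ 8 * t
    lemma₈ = solve-∀
  lemma : ∀ x p → x * x * (x * (x * (x * x * (x * (x * x * x * (x * x) * p)))))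
    ≡ x * (x * (x * (x * (x * (x * (x * (x * (x * (x * (x * (x * 1))))))))))) * p
  lemma = solve-∀

prime-cube : ∀ n s → 1 ≤ n → 1 ≤ s → 7 ≤ ⌈log₂ n ⌉ → ⌈log₂ n ⌉ ≤ s * s →
  ∃ λ p → Prime p × 8 < p × n ≤ p ^ 3 × p ^ 3 ≤ n * 2 ^ (21 * s)
prime-cube n s 1≤n 1≤s 7≤ℓ ℓ≤s² = result (prime-in-range e s e≤s²)
  where
  open ≤-Reasoning
  ℓ = ⌈log₂ n ⌉
  -- This is ⌈ℓ / 3⌉: then 2^(3e) ≥ 2^ℓ ≥ n, and ℓ ≥ 7 gives e ≥ 3, so that p > 8.
  e = (ℓ + 2) / 3
  ℓ≤3e : ℓ ≤ 3 * e
  ℓ≤3e = +-cancelʳ-≤ 2 ℓ (3 * e) (begin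
    ℓ + 2                       ≡⟨ m≡m%n+[m/n]*n (ℓ + 2) 3 ⟩
    (ℓ + 2) % 3 + e * 3         ≤⟨ +-monoˡ-≤ (e * 3) (s≤s⁻¹ (m%n<n (ℓ + 2) 3)) ⟩
    2 + e * 3                   ≡⟨ trans (+-comm 2 (e * 3)) (cong (_+ 2) (*-comm e 3)) ⟩
    3 * e + 2                   ∎)
  3e≤ℓ+2 : 3 * e ≤ ℓ + 2
  3e≤ℓ+2 = subst (_≤ ℓ + 2) (*-comm e 3) (m/n*n≤m (ℓ + 2) 3)
  3≤e : 3 ≤ e
  3≤e = *-cancelˡ-< 3 2 e (≤-trans 7≤ℓ ℓ≤3e)
  e≤s² : e ≤ s * s
  e≤s² = ≤-trans (*-cancelˡ-≤ 3 (≤-trans 3e≤ℓ+2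
    (+-monoʳ-≤ ℓ (≤-trans (s≤s (s≤s z≤n)) (≤-trans 7≤ℓ (m≤m+n ℓ (ℓ + 0))))))) ℓ≤s²
  n≤p³ : ∀ {p} → 2 ^ e < p → n ≤ p ^ 3
  n≤p³ {p} 2^e<p = begin
    n                  ≤⟨ n≤2^⌈log₂n⌉ n ⟩
    2 ^ ℓ              ≤⟨ ^-monoʳ-≤ 2 ℓ≤3e ⟩
    2 ^ (3 * e)        ≡⟨ cong (2 ^_) (*-comm 3 e) ⟩
    2 ^ (e * 3)        ≡⟨ ^-*-assoc 2 e 3 ⟨
    (2 ^ e) ^ 3        ≤⟨ ^-monoˡ-≤ 3 (<⇒≤ 2^e<p) ⟩
    p ^ 3              ∎
  t = 2 + (3 * s + 15)
  p³≤ : ∀ {p} → p ≤ 2 ^ (e + s + 5) → p ^ 3 ≤ n * 2 ^ (21 * s)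
  p³≤ {p} p≤ = begin
    p ^ 3                               ≤⟨ ^-monoˡ-≤ 3 p≤ ⟩
    (2 ^ (e + s + 5)) ^ 3               ≡⟨ ^-*-assoc 2 (e + s + 5) 3 ⟩
    2 ^ ((e + s + 5) * 3)               ≡⟨ cong (2 ^_) (lemma e s) ⟩
    2 ^ (3 * e + (3 * s + 15))          ≤⟨ ^-monoʳ-≤ 2 (+-monoˡ-≤ (3 * s + 15) 3e≤ℓ+2) ⟩
    2 ^ (ℓ + 2 + (3 * s + 15))          ≡⟨ cong (2 ^_) (+-assoc ℓ 2 (3 * s + 15)) ⟩
    2 ^ (ℓ + t)                         ≡⟨ ^-distribˡ-+-* 2 ℓ t ⟩
    2 ^ ℓ * 2 ^ t                       ≤⟨ *-monoˡ-≤ (2 ^ t) (2^⌈log₂n⌉≤2n n 1≤n) ⟩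
    2 * n * 2 ^ t                       ≡⟨ lemma′ n (2 ^ t) ⟩
    n * 2 ^ suc t                       ≤⟨ *-monoʳ-≤ n (^-monoʳ-≤ 2 exponent) ⟩
    n * 2 ^ (21 * s)                    ∎
    where
    lemma : ∀ e s → (e + s + 5) * 3 ≡ 3 * e + (3 * s + 15)
    lemma = solve-∀
    lemma′ : ∀ n t → 2 * n * t ≡ n * (2 * t)
    lemma′ = solve-∀
    lemma″ : ∀ s → 3 + (3 * s + 15) ≡ 3 * s + 18 * 1
    lemma″ = solve-∀
    -- Of the 18 here, 15 come from cubing 2^5, two from rounding ℓ / 3 and one from 2^ℓ ≤ 2n; 1 ≤ s
    -- turns them into a multiple of s.
    exponent : suc t ≤ 21 * s
    exponent = begin
      3 + (3 * s + 15)    ≡⟨ lemma″ s ⟩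
      3 * s + 18 * 1      ≤⟨ +-monoʳ-≤ (3 * s) (*-monoʳ-≤ 18 1≤s) ⟩
      3 * s + 18 * s      ≡⟨ *-distribʳ-+ s 3 18 ⟨
      21 * s              ∎

  result : (∃ λ p → Prime p × 2 ^ e < p × p ≤ 2 ^ (e + s + 5)) →
    ∃ λ p → Prime p × 8 < p × n ≤ p ^ 3 × p ^ 3 ≤ n * 2 ^ (21 * s)
  result (p , p-prime , 2^e<p , p≤) =
    p , p-prime , ≤-<-trans (^-monoʳ-≤ 2 3≤e) 2^e<p , n≤p³ 2^e<p , p³≤ p≤

half-bound : ∀ {p h} → 8 < p → p ≡ suc (h + h) → 4 ≤ h
half-bound {p} {h} 8<p p≡1+2h = ≮⇒≥ λ h<4 → <-irrefl refl (begin-strict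
  8                  <⟨ 8<p ⟩
  p                  ≡⟨ p≡1+2h ⟩
  suc (h + h)        ≤⟨ s≤s (+-mono-≤ (s≤s⁻¹ h<4) (s≤s⁻¹ h<4)) ⟩
  7                  <⟨ ≤-refl ⟩
  8                  ∎)
  where open ≤-Reasoning

-- Assembling the colouring from a prime and deducing the bound.

module PrimeColouring
  (n ℓ s p : ℕ) (p-prime : Prime p) (h : ℕ) (p≡1+2h : p ≡ suc (h + h)) (4≤h : 4 ≤ h)
  (m : ℤ) (anisotropic : ∀ z → ¬ Modular.V p p-prime (z ℤ.* z ℤ.+ m))
  (2≤n : 2 ≤ n) (n≤2^ℓ : n ≤ 2 ^ ℓ) (ℓ≤s² : ℓ ≤ s * s) (n≤p³ : n ≤ p ^ 3) where

  open Modular p p-prime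
  open Residues p p-prime
  open Shifts p p-prime h p≡1+2h 4≤h m anisotropic

  digit : Fin n → Fin 3 → Fin p
  digit = digits p 3 n≤p³

  point : Fin n → ℤ³
  point x = ⟨ ⌊ digit x zero ⌋ , ⌊ digit x (suc zero) ⌋ , ⌊ digit x (suc (suc zero)) ⌋ ⟩

  point-injective : ∀ {x y} → x ≢ y → ¬ V³ (point x ⊖ point y)
  point-injective {x} {y} x≢y (V₁ , V₂ , V₃) = x≢y (digits-injective p 3 n≤p³ λ
    { zero → V-Fin-injective _ _ V₁
    ; (suc zero) → V-Fin-injective _ _ V₂
    ; (suc (suc zero)) → V-Fin-injective _ _ V₃ })

  k : ℕ
  k = 4 * ℓ + 1

  distinct? : (xy : Fin n × Fin n) → Dec (proj₁ xy ≢ proj₂ xy)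
  distinct? (x , y) = ¬? (x FinP.≟ y)

  square pairs : List (Fin n × Fin n)
  square = cartesianProduct (allFin n) (allFin n)
  pairs = filter distinct? square

  points : Fin n × Fin n → ℤ³ × ℤ³
  points (x , y) = point x , point y

  few-pairs : length (map points pairs) * 2 ^ k < 3 ^ k
  few-pairs = ≤-<-trans (*-monoˡ-≤ (2 ^ k) (begin
    length (map points pairs)                 ≡⟨ length-map points pairs ⟩
    length pairs                              ≤⟨ length-filter distinct? square ⟩
    length square                             ≡⟨ length-cartesianProduct (allFin n) (allFin n) ⟩
    length (allFin n) * length (allFin n)     ≡⟨ cong₂ _*_ n-long n-long ⟩
    n * n                                     ∎)) (greedy-steps n ℓ n≤2^ℓ)
    where
    open ≤-Reasoning
    n-long : length (allFin n) ≡ n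
    n-long = length-tabulate {n = n} (λ i → i)

  separated : ∀ {a b} → (a , b) ∈ map points pairs → ¬ V³ (a ⊖ b)
  separated ab∈ with ∈-map⁻ points ab∈
  ... | (x , y) , xy∈ , refl = point-injective (proj₂ (∈-filter⁻ distinct? {xs = square} xy∈))

  Covering : (Fin k → Fin p) → Set
  Covering f = ∀ {a b} → (a , b) ∈ map points pairs →
    ∃ λ i → ∃ λ axis → Geometry.Good p p-prime m (shift axis (f i)) a b

  colouring-from : ∃ Covering → Σ (Colouring n (colours s k p)) (IsPQColouring 5 5)
  colouring-from (f , covers) = C.colouring , C.is-5-5
    where
    module C = Construction n s k p p-prime m m≢0 2≤n (≤-trans n≤2^ℓ (^-monoʳ-≤ 2 ℓ≤s²))
      point point-injective (λ axis i → shift axis (f i))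
      (λ {x} {y} x≢y → covers {point x} {point y} (∈-map⁺ points
        (∈-filter⁺ distinct? (∈-cartesianProduct⁺ (∈-allFin x) (∈-allFin y)) x≢y)))

  colouring-exists : Σ (Colouring n (colours s k p)) (IsPQColouring 5 5)
  colouring-exists = colouring-from (good-shifts k (map points pairs) separated few-pairs)

-- Cubing replaces n^(1/3) by n. The factor 2^(12 s) contributes 36 s to the exponent and p³
-- contributes 21 s.
colours³-bound : ∀ n s ℓ p L → 1 ≤ s → ℓ ≤ s * s → 1 ≤ L → p ^ 3 ≤ n * 2 ^ (21 * s) →
  colours s (4 * ℓ + 1) p ^ 3 ≤ n * 2 ^ (57 * (s * L))
colours³-bound n s ℓ p L 1≤s ℓ≤s² 1≤L p³≤ = begin
  colours s (4 * ℓ + 1) p ^ 3         ≤⟨ ^-monoˡ-≤ 3 (colours-bound s ℓ p 1≤s ℓ≤s²) ⟩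
  (2 ^ (12 * s) * p) ^ 3              ≡⟨ lemma (2 ^ (12 * s)) p ⟩
  (2 ^ (12 * s)) ^ 3 * p ^ 3          ≡⟨ cong (_* p ^ 3) (^-*-assoc 2 (12 * s) 3) ⟩
  2 ^ (12 * s * 3) * p ^ 3            ≤⟨ *-monoʳ-≤ (2 ^ (12 * s * 3)) p³≤ ⟩
  2 ^ (12 * s * 3) * (n * 2 ^ (21 * s)) ≡⟨ lemma′ (2 ^ (12 * s * 3)) n (2 ^ (21 * s)) ⟩
  n * (2 ^ (12 * s * 3) * 2 ^ (21 * s)) ≡⟨ cong (n *_) (^-distribˡ-+-* 2 (12 * s * 3) (21 * s)) ⟨
  n * 2 ^ (12 * s * 3 + 21 * s)       ≡⟨ cong (λ t → n * 2 ^ t) (lemma″ s) ⟩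
  n * 2 ^ (57 * (s * 1))              ≤⟨ *-monoʳ-≤ n (^-monoʳ-≤ 2 (*-monoʳ-≤ 57 (*-monoʳ-≤ s 1≤L))) ⟩
  n * 2 ^ (57 * (s * L))              ∎
  where
  open ≤-Reasoning
  lemma : ∀ a b → (a * b) * ((a * b) * ((a * b) * 1)) ≡ (a * (a * (a * 1))) * (b * (b * (b * 1)))
  lemma = solve-∀
  lemma′ : ∀ a n b → a * (n * b) ≡ n * (a * b)
  lemma′ = solve-∀
  lemma″ : ∀ s → 12 * s * 3 + 21 * s ≡ 57 * (s * 1)
  lemma″ = solve-∀

five-five-colouring : ∀ n ℓ s p → Prime p → 8 < p → 2 ≤ n → n ≤ 2 ^ ℓ → ℓ ≤ s * s → n ≤ p ^ 3 →
  Σ (Colouring n (colours s (4 * ℓ + 1) p)) (IsPQColouring 5 5)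
five-five-colouring n ℓ s p p-prime 8<p 2≤n n≤2^ℓ ℓ≤s² n≤p³ =
  let (h , p≡1+2h) = odd-prime p-prime (≤-trans (s≤s (s≤s (s≤s z≤n))) 8<p)
      4≤h = half-bound 8<p p≡1+2h
      (η , nonsquare) = Residues.nonresidue p p-prime h p≡1+2h (≤-trans (s≤s z≤n) 4≤h)
  -- With m = - η the non-square η is - m, so z² + m never vanishes.
  in PrimeColouring.colouring-exists n ℓ s p p-prime h p≡1+2h 4≤h (ℤ.- η)
       nonsquare 2≤n n≤2^ℓ ℓ≤s² n≤p³

theorem1 : Σ ℕ λ C → Σ ℕ λ N → (n : ℕ) → n ≥ N →
    Σ ℕ λ k → (k ^ 3 ≤ n * 2 ^ (C * (⌈√ ⌈log₂ n ⌉ ⌉ * ⌈log₂ ⌈log₂ n ⌉ ⌉))) × fAtMost n 5 5 k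
-- 57 = 3 · 12 + 21 is the exponent from `colours³-bound`, and 128 = 2^7 ensures ⌈log₂ n⌉ ≥ 7, as
-- `prime-cube` requires.
theorem1 = 57 , 128 , λ n 128≤n →
  let ℓ = ⌈log₂ n ⌉
      s = ⌈√ ℓ ⌉
      7≤ℓ : 7 ≤ ℓ
      7≤ℓ = ⌈log₂⌉-mono-≤ {128} 128≤n
      ℓ≤s² = ⌈√⌉-upper ℓ
      1≤s : 1 ≤ s
      1≤s = n≢0⇒n>0 λ s≡0 → contradiction (≤-trans 7≤ℓ (subst (λ s → ℓ ≤ s * s) s≡0 ℓ≤s²)) λ ()
      (p , p-prime , 8<p , n≤p³ , p³≤) = prime-cube n s (≤-trans (s≤s z≤n) 128≤n) 1≤s 7≤ℓ ℓ≤s²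
  in colours s (4 * ℓ + 1) p
   , colours³-bound n s ℓ p ⌈log₂ ℓ ⌉ 1≤s ℓ≤s² (⌈log₂⌉-mono-≤ {2} (≤-trans (s≤s (s≤s z≤n)) 7≤ℓ)) p³≤
   , _ , ≤-refl
   , five-five-colouring n ℓ s p p-prime 8<p (≤-trans (s≤s (s≤s z≤n)) 128≤n) (n≤2^⌈log₂n⌉ n) ℓ≤s² n≤p³
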